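{- Let $k\geq 1$ be an integer and let $\mathcal{G}$ be the class of triangle-free graphs with treewidth at most $k$. Then the defective chromatic number of $\mathcal{G}$, the clustered chromatic number of $\mathcal{G}$, and the (proper) chromatic number of $\mathcal{G}$ all equal $\left\lceil \frac{k+3}{2}\right\rceil$.
   Context: Graphs are finite, simple and undirected. A $k$-colouring of a graph assigns one of at most $k$ colours to each vertex (not necessarily properly). A monochromatic component is a connected component of the subgraph induced by all vertices of a single colour. A colouring has defect $d$ if every monochromatic component has maximum degree at most $d$, and has clustering $c$ if every monochromatic component has at most $c$ vertices. For a graph class $\mathcal{G}$: the chromatic number of $\mathcal{G}$ is $\max\{\chi(G):G\in\mathcal{G}\}$, where $\chi(G)$ is the usual (proper) chromatic number; the defective chromatic number of $\mathcal{G}$ is the minimum integer $k$ for which there exists an integer $d$ such that every graph in $\mathcal{G}$ is $k$-colourable with defect $d$; the clustered chromatic number of $\mathcal{G}$ is the minimum integer $k$ for which there exists an integer $c$ such that every graph in $\mathcal{G}$ is $k$-colourable with clustering $c$. (Each is called unbounded if the relevant maximum or minimum does not exist.) Treewidth is the minimum, over all tree-decompositions, of the maximum bag size minus one. -}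

module Defs where

open import Data.Empty using (⊥)
open import Data.Fin using (Fin)
open import Data.Fin.Subset using (Subset; _∈_; _⊆_; _∩_; ∣_∣)
open import Data.Fin.Subset.Properties using (_∈?_)
open import Data.List using (List; []; _∷_; [_]; _++_; map; filter; allFin; length)
open import Data.List.Extrema.Nat using (max)
open import Data.List.Relation.Unary.Linked using (Linked)
open import Data.List.Relation.Unary.Unique.Propositional using (Unique)
open import Data.Nat using (ℕ; _≤_; _∸_)
open import Data.Product using (∃; ∃-syntax; _×_)
open import Data.Vec using (tabulate)
open import Function using (_∘_)
open import Level using (Level; 0ℓ) renaming (suc to lsuc)
open import Relation.Binary.Core using (Rel)
open import Relation.Binary.Construct.Closure.ReflexiveTransitive using (Star)
open import Relation.Binary.Definitions using (Decidable; Symmetric; Irreflexive)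
open import Relation.Binary.PropositionalEquality using (_≡_; _≢_)
open import Relation.Nullary using (¬_; does)
open import Relation.Unary using (Pred; U; Satisfiable)

IsMinimum : {ℓ : Level} → (ℕ → Set ℓ) → ℕ → Set ℓ
IsMinimum P m = P m × (∀ j → P j → m ≤ j)

IsMaximum : {ℓ : Level} → (ℕ → Set ℓ) → ℕ → Set ℓ
IsMaximum P m = P m × (∀ j → P j → j ≤ m)

record Graph : Set₁ where
  infix 4 _~_ _~?_
  field
    order  : ℕ
    _~_    : Rel (Fin order) 0ℓ
    _~?_   : Decidable _~_
    ~-sym  : Symmetric _~_
    ~-irr  : Irreflexive _≡_ _~_

  Vertex : Set
  Vertex = Fin order

  neighbours : Vertex → Subset order
  neighbours v = tabulate (λ u → does (v ~? u))

open Graph using (Vertex; order; neighbours)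

GraphClass : Set₂
GraphClass = Pred Graph (lsuc 0ℓ)

module _ (G : Graph) where
  open Graph G using (_~_)

  Induced : Pred (Vertex G) 0ℓ → Rel (Vertex G) 0ℓ
  Induced P u v = P u × P v × u ~ v

  -- The subgraph induced by P is connected; in particular it has a vertex.
  Connected : Pred (Vertex G) 0ℓ → Set
  Connected P = Satisfiable P × (∀ {u v} → P u → P v → Star (Induced P) u v)

  -- C is the vertex set of a component (a maximal connected subgraph) of the
  -- subgraph induced by P.
  IsComponent : Pred (Vertex G) 0ℓ → Subset (order G) → Set
  IsComponent P C =
    (∀ {v} → v ∈ C → P v) ×
    Connected (_∈ C) ×
    (∀ D → C ⊆ D → (∀ {v} → v ∈ D → P v) → Connected (_∈ D) → D ⊆ C)

  degreeIn : Subset (order G) → Vertex G → ℕ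
  degreeIn C v = ∣ neighbours G v ∩ C ∣

  -- The maximum degree of the subgraph induced by C.
  maxDegree : Subset (order G) → ℕ
  maxDegree C = max 0 (map (degreeIn C) (filter (_∈? C) (allFin (order G))))

  TriangleFree : Set
  TriangleFree = ∀ {u v w} → u ~ v → v ~ w → ¬ (u ~ w)

  IsCycle : List (Vertex G) → Set
  IsCycle []       = ⊥
  IsCycle (v ∷ vs) =
    2 ≤ length vs × Unique (v ∷ vs) × Linked _~_ (v ∷ vs ++ [ v ])

  IsTree : Set
  IsTree = Connected U × (∀ vs → ¬ IsCycle vs)

record TreeDecomposition (G : Graph) : Set₁ where
  open Graph G using (_~_)
  field
    tree      : Graph
    isTree    : IsTree tree
    bag       : Vertex tree → Subset (order G)
    edge-bag  : ∀ {u v} → u ~ v → ∃[ t ] (u ∈ bag t × v ∈ bag t)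
    connected : ∀ v → Connected tree (λ t → v ∈ bag t)

  -- Truncated subtraction matters only for the graph with no vertices, which
  -- may have width 0 here instead of -1.
  width : ℕ
  width = max 0 (map (∣_∣ ∘ bag) (allFin (order tree))) ∸ 1

TreewidthAtMost : ℕ → GraphClass
TreewidthAtMost k G = ∃ λ (D : TreeDecomposition G) → TreeDecomposition.width D ≤ k

Colouring : Graph → ℕ → Set
Colouring G k = Vertex G → Fin k

module _ (G : Graph) {k : ℕ} (c : Colouring G k) where
  open Graph G using (_~_)

  Proper : Set
  Proper = ∀ {u v} → u ~ v → c u ≢ c v

  IsMonochromaticComponent : Subset (order G) → Set
  IsMonochromaticComponent C = ∃[ i ] IsComponent G (λ v → c v ≡ i) C

  HasDefect : ℕ → Set
  HasDefect d = ∀ C → IsMonochromaticComponent C → maxDegree G C ≤ d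

  HasClustering : ℕ → Set
  HasClustering s = ∀ C → IsMonochromaticComponent C → ∣ C ∣ ≤ s

IsChromaticNumber : Graph → ℕ → Set
IsChromaticNumber G = IsMinimum (λ k → ∃ λ (c : Colouring G k) → Proper G c)

IsClassChromaticNumber : GraphClass → ℕ → Set₁
IsClassChromaticNumber 𝒢 = IsMaximum (λ j → ∃[ G ] (𝒢 G × IsChromaticNumber G j))

IsDefectiveChromaticNumber : GraphClass → ℕ → Set₁
IsDefectiveChromaticNumber 𝒢 = IsMinimum λ k →
  ∃[ d ] (∀ G → 𝒢 G → ∃ λ (c : Colouring G k) → HasDefect G c d)

IsClusteredChromaticNumber : GraphClass → ℕ → Set₁
IsClusteredChromaticNumber 𝒢 = IsMinimum λ k →
  ∃[ s ] (∀ G → 𝒢 G → ∃ λ (c : Colouring G k) → HasClustering G c s)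

TriangleFreeTreewidthAtMost : ℕ → GraphClass
TriangleFreeTreewidthAtMost k G = TriangleFree G × TreewidthAtMost k G

{-# OPTIONS --safe #-}
module Submission where

-- Upper bound.  Put m = ⌈(k+1)/2⌉, so that a bag has at most 2m vertices, and use
-- m + 1 colours.  Walk through the tree, colouring properly one bag at a time, so
-- that in each bag the vertices can be placed in m slots of size two in which any
-- two vertices sharing a slot are adjacent or have the same colour.  Then an
-- independent set in the bag has at most m colours, in particular the neighbours
-- of a new vertex do, and a local exchange along an alternating path keeps the
-- slots when a new vertex is coloured.
--
-- Lower bound.  Put q = ⌊k/2⌋.  Against a colouring with q + 1 colours and defect d
-- one grows a rainbow independent set in a bag.  Given one, {u₁, …, uᵢ} with i ≤ q,
-- attach many vertices to u₁, …, uⱼ, for which vertices x₁, …, xⱼ with the same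
-- colours are already known; one of them avoids these colours.  It becomes xⱼ₊₁
-- after renumbering, or together with x₁, …, xⱼ, uⱼ₊₁, …, uᵢ it is a rainbow
-- independent set of size i + 1.  This needs bags of at most 2i + 1 vertices.  Many
-- vertices attached to a rainbow set of size q + 1 finally force another colour.

open import Defs
open import Data.Bool using (true; false)
open import Data.Empty using (⊥; ⊥-elim)
open import Data.Fin as Fin using (Fin; zero; suc; toℕ; fromℕ<; opposite; _≟_; combine; remQuot)
open import Data.Fin.Properties using
  (any?; pigeonhole; ¬∀⟶∃¬; combine-remQuot; <⇒≢; toℕ<n; toℕ-injective; toℕ-fromℕ<; fromℕ<-toℕ)
open import Data.Fin.Subset using (Subset; _∈_; _∉_; _⊆_; _∩_; _∪_; ⁅_⁆; ∣_∣) renaming (⊥ to ∅)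
open import Data.Fin.Subset.Properties
open import Data.List using (List; []; _∷_; [_]; _++_; length; map; filter; allFin; tabulate)
open import Data.List.Extrema.Nat using (xs≤max; max≤v⁺)
import Data.List.Membership.DecPropositional as DecList
open import Data.List.Membership.Propositional using () renaming (_∈_ to _∈ˡ_; _∉_ to _∉ˡ_)
open import Data.List.Membership.Propositional.Properties
open import Data.List.Properties using (++-assoc; filter-notAll; length-++; length-map; length-tabulate; length-upTo; map-++)
open import Data.List.Relation.Binary.Permutation.Propositional using (_↭_; ↭-sym; prep; ↭⇒↭ₛ; module PermutationReasoning)
import Data.List.Relation.Binary.Permutation.Propositional.Properties as ↭
import Data.List.Relation.Binary.Permutation.Setoid.Properties as ↭ₛ
open import Data.List.Relation.Binary.Subset.Propositional using () renaming (_⊆_ to _⊆ˡ_)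
open import Data.List.Relation.Binary.Subset.Propositional.Properties using (∷⁺ʳ)
open import Data.List.Relation.Unary.All using (All; []; _∷_)
import Data.List.Relation.Unary.All as All
import Data.List.Relation.Unary.All.Properties as All
open import Data.List.Relation.Unary.AllPairs using ([]; _∷_)
open import Data.List.Relation.Unary.Any using (here; there)
import Data.List.Relation.Unary.Any as Any
open import Data.List.Relation.Unary.Linked using (Linked; [-]; _∷_)
open import Data.List.Relation.Unary.Unique.Propositional using (Unique)
import Data.List.Relation.Unary.Unique.Propositional.Properties as Unique
open import Data.Nat using (ℕ; zero; suc; _+_; _*_; _≤_; _<_; z≤n; s≤s; s≤s⁻¹; _<?_; _≤?_; ⌊_/2⌋; ⌈_/2⌉)
import Data.Nat.Properties as ℕ
open import Data.List.Membership.DecPropositional ℕ._≟_ using () renaming (_∈?_ to _∈ˡ?_)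
open import Data.Product using (∃; ∃₂; ∃-syntax; _×_; _,_; proj₁; proj₂)
open import Data.Product.Properties using (≡-dec)
open import Data.Sum using (_⊎_; inj₁; inj₂; [_,_]′; swap)
open import Data.Unit using (tt)
import Data.Vec as Vec
open import Data.Vec using ([]; _∷_; here; there)
open import Data.Vec.Functional using (updateAt)
open import Data.Vec.Functional.Properties using (updateAt-updates; updateAt-minimal)
open import Data.Vec.Properties using (lookup∘tabulate; lookup⇒[]=; []=⇒lookup)
open import Function using (_∘_; id; const; _$_)
open import Level using (0ℓ)
open import Relation.Binary.Construct.Closure.ReflexiveTransitive using (Star; ε; _◅_; _◅◅_; reverse)
import Relation.Binary.Construct.Closure.ReflexiveTransitive as Star
open import Relation.Binary.Core using (Rel)
open import Relation.Binary.PropositionalEquality hiding ([_])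
open import Relation.Nullary using (Dec; ¬_; yes; no; does; contradiction; ¬?; _×-dec_; _⊎-dec_)
open import Relation.Nullary.Decidable using (decidable-stable; dec-true)
open import Relation.Unary using (Pred; Decidable)

-- Point updates of functions and counting in finite subsets

module _ {n : ℕ} {A : Set} where

  _[_↦_] : (Fin n → A) → Fin n → A → Fin n → A
  f [ i ↦ a ] = updateAt f i (const a)

  ↦-same : (f : Fin n → A) (i : Fin n) {a : A} → (f [ i ↦ a ]) i ≡ a
  ↦-same f i = updateAt-updates i f

  ↦-other : (f : Fin n → A) (i : Fin n) {a : A} {j : Fin n} → j ≢ i → (f [ i ↦ a ]) j ≡ f j
  ↦-other f i {j = j} = updateAt-minimal j i f

length-unique≤ : ∀ {n} {S : Subset n} {xs : List (Fin n)} → Unique xs → All (_∈ S) xs → length xs ≤ ∣ S ∣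
length-unique≤ []        []        = z≤n
length-unique≤ (x∉ ∷ un) (x∈ ∷ ⊆S) =
  ℕ.≤-trans (s≤s (length-unique≤ un (All.zipWith (λ (x≢y , y∈) → x∈p∧x≢y⇒x∈p-y y∈ (x≢y ∘ sym)) (x∉ , ⊆S))))
            (x∈p⇒∣p-x∣<∣p∣ x∈)

-- Colouring one more vertex of a bag

fin2-unique : {a b c : Fin 2} → a ≢ c → b ≢ c → a ≡ b
fin2-unique {zero}     {zero}     _   _   = refl
fin2-unique {suc zero} {suc zero} _   _   = refl
fin2-unique {zero}     {suc zero} {zero}     a≢c _   = contradiction refl a≢c
fin2-unique {zero}     {suc zero} {suc zero} _   b≢c = contradiction refl b≢c
fin2-unique {suc zero} {zero}     {zero}     _   b≢c = contradiction refl b≢c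
fin2-unique {suc zero} {zero}     {suc zero} a≢c _   = contradiction refl a≢c

opposite-≢ : {a : Fin 2} → a ≢ opposite a
opposite-≢ {zero}     ()
opposite-≢ {suc zero} ()

module _ (G : Graph) (tf : TriangleFree G) (m : ℕ) where
  open Graph G

  ProperOn : Colouring G (suc m) → Subset order → Set
  ProperOn c S = ∀ {u v} → u ∈ S → v ∈ S → u ~ v → c u ≢ c v

  Placement : Set
  Placement = Vertex → Fin m × Fin 2

  slot : Placement → Vertex → Fin m
  slot pos u = proj₁ (pos u)

  -- Each slot holds at most two vertices of S, and two vertices in one slot
  -- cannot be independent with different colours.  Hence an independent
  -- subset of S sees at most m colours.
  record Certificate (c : Colouring G (suc m)) (S : Subset order) (pos : Placement) : Set where
    field
      injective : ∀ {u v} → u ∈ S → v ∈ S → pos u ≡ pos v → u ≡ v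
      paired    : ∀ {u v} → u ∈ S → v ∈ S → slot pos u ≡ slot pos v → c u ≡ c v ⊎ u ~ v

  open Certificate

  Free : Subset order → Placement → Fin m × Fin 2 → Set
  Free S pos π = ∀ {u} → u ∈ S → pos u ≢ π

  -- If all `m * 2` positions were hit, their occupants would be that many distinct vertices of `S`.
  free-position : ∀ {S} (pos : Placement) → ∣ S ∣ < m * 2 → ∃ (Free S pos)
  free-position {S} pos ∣S∣<2m =
    let i , ¬hit = ¬∀⟶∃¬ _ Hit hit? not-all
    in remQuot 2 i , λ u∈ eq → ¬hit (_ , u∈ , eq)
    where
    Hit : Fin (m * 2) → Set
    Hit i = ∃[ u ] (u ∈ S × pos u ≡ remQuot 2 i)

    hit? : ∀ i → Dec (Hit i)
    hit? i = any? λ u → (u ∈? S) ×-dec ≡-dec _≟_ _≟_ (pos u) (remQuot 2 i)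

    module _ (hit : ∀ i → Hit i) where
      occupant : Fin (m * 2) → Vertex
      occupant i = proj₁ (hit i)

      position : Vertex → Fin (m * 2)
      position u = combine (proj₁ (pos u)) (proj₂ (pos u))

      position-occupant : ∀ i → position (occupant i) ≡ i
      position-occupant i =
        trans (cong (λ (σ , b) → combine σ b) (proj₂ (proj₂ (hit i)))) (combine-remQuot {m} 2 i)

      occupant-injective : ∀ {i j} → occupant i ≡ occupant j → i ≡ j
      occupant-injective {i} {j} eq =
        trans (sym (position-occupant i)) (trans (cong position eq) (position-occupant j))

      occupant∈S : ∀ {u} → u ∈ˡ tabulate occupant → u ∈ S
      occupant∈S u∈ with i , refl ← ∈-tabulate⁻ u∈ = proj₁ (proj₂ (hit i))

      not-all : ⊥
      not-all = ℕ.<⇒≱ ∣S∣<2m (subst (_≤ ∣ S ∣) (length-tabulate occupant)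
        (length-unique≤ (Unique.tabulate⁺ occupant-injective) (All.tabulate occupant∈S)))

  Unused : Colouring G (suc m) → Subset order → Vertex → Fin (suc m) → Set
  Unused c S v x = ∀ {w} → w ∈ S → v ~ w → c w ≢ x

  Used : Colouring G (suc m) → Subset order → Vertex → Fin (suc m) → Set
  Used c S v x = ∃[ w ] (w ∈ S × v ~ w × c w ≡ x)

  used? : ∀ c S v x → Dec (Used c S v x)
  used? c S v x = any? λ w → (w ∈? S) ×-dec ((v ~? w) ×-dec (c w ≟ x))

  -- The neighbours of v are independent, so they miss some colour.
  unused-colour : ∀ {c S pos} → Certificate c S pos → ∀ v → ∃ (Unused c S v)
  unused-colour {c} {S} {pos} cert v with any? (λ x → ¬? (used? c S v x))
  ... | yes (x , unused) = x , λ w∈ v~w cw≡x → unused (_ , w∈ , v~w , cw≡x)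
  ... | no all-used = ⊥-elim (clash (pigeonhole ℕ.≤-refl (slot pos ∘ proj₁ ∘ used)))
    where
    used : ∀ x → Used c S v x
    used x = decidable-stable (used? c S v x) λ ¬used → all-used (x , ¬used)

    clash : (∃₂ λ x y → x Fin.< y × slot pos (proj₁ (used x)) ≡ slot pos (proj₁ (used y))) → ⊥
    clash (x , y , x<y , same) with used x | used y
    ... | w , w∈ , v~w , refl | w′ , w′∈ , v~w′ , refl with paired cert w∈ w′∈ same
    ... | inj₁ cw≡cw′ = <⇒≢ x<y cw≡cw′
    ... | inj₂ w~w′   = tf v~w w~w′ v~w′

  -- What `paired` will demand once `v` enters slot `σ` with colour `x`.
  Fits : Colouring G (suc m) → Subset order → Placement → Vertex → Fin m → Fin (suc m) → Set
  Fits c S pos v σ x = ∀ {w} → w ∈ S → slot pos w ≡ σ → c w ≡ x ⊎ v ~ w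

  -- The colouring `c` stays as it is; only the placement may be rearranged to make room for `v`.
  Placeable : Colouring G (suc m) → Subset order → Vertex → Set
  Placeable c S v = ∃[ pos ] ∃[ π ] ∃[ x ]
    (Certificate c S pos × Free S pos π × Unused c S v x × Fits c S pos v (proj₁ π) x)

  -- A slot has two positions. As `π` is free, both vertices sit in the other one.
  partner-unique : ∀ {c S pos π u w} → Certificate c S pos → Free S pos π →
    u ∈ S → w ∈ S → slot pos u ≡ proj₁ π → slot pos w ≡ proj₁ π → u ≡ w
  partner-unique cert free u∈ w∈ refl sw = injective cert u∈ w∈
    (cong₂ _,_ (sym sw) (fin2-unique (free u∈ ∘ cong (_ ,_)) (free w∈ ∘ cong₂ _,_ sw)))

  module _ {c : Colouring G (suc m)} {S : Subset order} {pos : Placement} (cert : Certificate c S pos)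
           {z : Vertex} {π : Fin m × Fin 2} (z∈ : z ∈ S) (free : Free S pos π)
           (same-colour : ∀ {w} → w ∈ S → slot pos w ≡ proj₁ π → c w ≡ c z) where

    move : Placement
    move = pos [ z ↦ π ]

    move-slot : ∀ {u} → u ≢ z → slot move u ≡ slot pos u
    move-slot u≢z = cong proj₁ (↦-other pos z u≢z)

    moved-slot : slot move z ≡ proj₁ π
    moved-slot = cong proj₁ (↦-same pos z)

    -- Whoever already sits in the slot of `π` has the colour of `z`, so the pair created there is
    -- harmless.
    move-certificate : Certificate c S move
    move-certificate = record { injective = inj ; paired = pair }
      where
      inj : ∀ {u v} → u ∈ S → v ∈ S → move u ≡ move v → u ≡ v
      inj {u} {v} u∈ v∈ eq with u ≟ z | v ≟ z
      ... | yes refl | yes refl = refl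
      ... | yes refl | no v≢z   = contradiction (trans (sym (↦-other pos z v≢z)) (trans (sym eq) (↦-same pos z))) (free v∈)
      ... | no u≢z   | yes refl = contradiction (trans (sym (↦-other pos z u≢z)) (trans eq (↦-same pos z))) (free u∈)
      ... | no u≢z   | no v≢z   = injective cert u∈ v∈ (trans (sym (↦-other pos z u≢z)) (trans eq (↦-other pos z v≢z)))

      pair : ∀ {u v} → u ∈ S → v ∈ S → slot move u ≡ slot move v → c u ≡ c v ⊎ u ~ v
      pair {u} {v} u∈ v∈ eq with u ≟ z | v ≟ z
      ... | yes refl | yes refl = inj₁ refl
      ... | yes refl | no v≢z   =
        inj₁ (sym (same-colour v∈ (trans (sym (move-slot v≢z)) (trans (sym eq) moved-slot))))
      ... | no u≢z   | yes refl =
        inj₁ (same-colour u∈ (trans (sym (move-slot u≢z)) (trans eq moved-slot)))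
      ... | no u≢z   | no v≢z   =
        paired cert u∈ v∈ (trans (sym (move-slot u≢z)) (trans eq (move-slot v≢z)))

    -- The move fills one free position and opens another, so the exchange can go on from there.
    move-free : Free S move (pos z)
    move-free {u} u∈ eq with u ≟ z
    ... | yes refl = free z∈ (trans (sym eq) (↦-same pos z))
    ... | no u≢z   = u≢z (injective cert u∈ z∈ (trans (sym (↦-other pos z u≢z)) eq))

  TwoColoured⊆ : Colouring G (suc m) → Subset order → Placement → List (Fin m) → Set
  TwoColoured⊆ c S pos A =
    ∀ {x y} → x ∈ S → y ∈ S → slot pos x ≡ slot pos y → c x ≢ c y → slot pos x ∈ˡ A

  -- If the vertex u sharing the slot of the free position π does not go with v,
  -- then a neighbour w of v with the colour of u joins u, and v is offered the
  -- slot of w.  The list A shrinks because that slot no longer has two colours.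
  place : ∀ {c S} v pos (A : List (Fin m)) fuel → length A ≤ fuel →
    Certificate c S pos → TwoColoured⊆ c S pos A → ∀ π → Free S pos π → Placeable c S v
  place {c} {S} v pos A fuel ∣A∣≤fuel cert covers π free
    with any? (λ u → (u ∈? S) ×-dec (slot pos u ≟ proj₁ π))
  ... | no empty = let x , unused = unused-colour cert v in
    pos , π , x , cert , free , unused , λ w∈ eq → contradiction (_ , w∈ , eq) empty
  ... | yes (u , u∈ , su≡σ) with v ~? u
  ... | yes v~u = let x , unused = unused-colour cert v in
    pos , π , x , cert , free , unused , λ w∈ eq →
      inj₂ (subst (v ~_) (partner-unique cert free u∈ w∈ su≡σ eq) v~u)
  ... | no _ with used? c S v (c u)
  -- No neighbour of `v` has the colour of `u`, so `v` can take that colour and share the slot with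
  -- `u`.
  ... | no unused = pos , π , c u , cert , free , (λ w∈ v~w eq → unused (_ , w∈ , v~w , eq)) , λ w∈ eq →
      inj₁ (cong c (partner-unique cert free w∈ u∈ eq su≡σ))
  ... | yes (w , w∈ , v~w , cw≡cu)
    with any? (λ w′ → (w′ ∈? S) ×-dec ((slot pos w′ ≟ slot pos w) ×-dec ¬? (w′ ≟ w)))
  ... | no alone = let x , unused = unused-colour cert v in
    pos , (slot pos w , opposite (proj₂ (pos w))) , x , cert , free′ , unused , λ z∈ eq →
      inj₂ (subst (v ~_) (sym (only-w z∈ eq)) v~w)
    where
    only-w : ∀ {z} → z ∈ S → slot pos z ≡ slot pos w → z ≡ w
    only-w {z} z∈ eq = decidable-stable (z ≟ w) λ z≢w → alone (z , z∈ , eq , z≢w)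

    free′ : Free S pos (slot pos w , opposite (proj₂ (pos w)))
    free′ z∈ eq with only-w z∈ (cong proj₁ eq)
    ... | refl = opposite-≢ (cong proj₂ eq)
  ... | yes (w′ , w′∈ , sw′≡sw , w′≢w) with c w′ ≟ c w
  -- `w′` also has the colour of `u`, so it can join `u` instead of `w`, and `v` takes its place
  -- beside the neighbour `w`.
  ... | yes cw′≡cw = let x , unused = unused-colour cert v in
    move cert w′∈ free same , pos w′ , x , cert′ , free′ , unused , λ z∈ eq →
      inj₂ (subst (v ~_) (partner-unique cert′ free′ w∈ z∈ sw′ eq) v~w)
    where
    same : ∀ {z} → z ∈ S → slot pos z ≡ proj₁ π → c z ≡ c w′
    same z∈ eq = trans (cong c (partner-unique cert free z∈ u∈ eq su≡σ)) (trans (sym cw≡cu) (sym cw′≡cw))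
    cert′ = move-certificate cert w′∈ free same
    free′ = move-free cert w′∈ free same
    sw′ : slot (move cert w′∈ free same) w ≡ slot pos w′
    sw′ = trans (move-slot cert w′∈ free same (w′≢w ∘ sym)) (sym sw′≡sw)
  ... | no cw′≢cw = recurse fuel ∣A∣≤fuel
    where
    same : ∀ {z} → z ∈ S → slot pos z ≡ proj₁ π → c z ≡ c w
    same z∈ eq = trans (cong c (partner-unique cert free z∈ u∈ eq su≡σ)) (sym cw≡cu)
    pos′ = move cert w∈ free same
    cert′ = move-certificate cert w∈ free same
    free′ = move-free cert w∈ free same
    stay : ∀ {z} → z ≢ w → slot pos′ z ≡ slot pos z
    stay = move-slot cert w∈ free same
    go : slot pos′ w ≡ proj₁ π
    go = moved-slot cert w∈ free same
    A′ = filter (λ τ → ¬? (τ ≟ slot pos w)) A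

    w-slot∈A : slot pos w ∈ˡ A
    w-slot∈A = covers w∈ w′∈ (sym sw′≡sw) (cw′≢cw ∘ sym)

    covers′ : TwoColoured⊆ c S pos′ A′
    covers′ {x} {y} x∈ y∈ eq cx≢cy with x ≟ w | y ≟ w
    ... | yes refl | yes refl = contradiction refl cx≢cy
    ... | yes refl | no y≢w   = contradiction (sym (same y∈ (trans (sym (stay y≢w)) (trans (sym eq) go)))) cx≢cy
    ... | no x≢w   | yes refl = contradiction (same x∈ (trans (sym (stay x≢w)) (trans eq go))) cx≢cy
    ... | no x≢w   | no y≢w   = ∈-filter⁺ _
      (subst (_∈ˡ A) (sym (stay x≢w)) (covers x∈ y∈ (trans (sym (stay x≢w)) (trans eq (stay y≢w))) cx≢cy))
      -- The slot that `w` left has a free position, so two vertices of `S` in it coincide and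
      -- cannot differ in colour.
      (λ τ≡ → cx≢cy (cong c (partner-unique cert′ free′ x∈ y∈ τ≡ (trans (sym eq) τ≡))))

    recurse : ∀ fuel → length A ≤ fuel → Placeable c S v
    recurse zero       ∣A∣≤0 = contradiction ∣A∣≤0 (ℕ.<⇒≱ (∈-length w-slot∈A))
    recurse (suc fuel) ∣A∣≤  = place v pos′ A′ fuel
      (s≤s⁻¹ (ℕ.≤-trans (filter-notAll _ A (Any.map (λ eq ≢ → ≢ (sym eq)) w-slot∈A)) ∣A∣≤))
      cert′ covers′ (pos w) free′

-- Completing the colouring of a bag

∪-singleton⁻ : ∀ {n} {S : Subset n} {u v} → u ∈ S ∪ ⁅ v ⁆ → u ≢ v → u ∈ S
∪-singleton⁻ {S = S} {v = v} u∈ u≢v with x∈p∪q⁻ S ⁅ v ⁆ u∈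
... | inj₁ u∈S = u∈S
... | inj₂ u∈v = contradiction (x∈⁅y⁆⇒x≡y v u∈v) u≢v

module _ (G : Graph) (tf : TriangleFree G) (m : ℕ) where
  open Graph G

  Good : Colouring G (suc m) → Subset order → Set
  Good c S = ProperOn G tf m c S × ∃ (Certificate G tf m c S)

  Good-⊆ : ∀ {c S T} → T ⊆ S → Good c S → Good c T
  Good-⊆ T⊆S (proper , pos , cert) =
    (λ u∈ v∈ → proper (T⊆S u∈) (T⊆S v∈)) ,
    pos , record { injective = λ u∈ v∈ → injective (T⊆S u∈) (T⊆S v∈)
                 ; paired    = λ u∈ v∈ → paired (T⊆S u∈) (T⊆S v∈) }
    where open Certificate cert

  Good-cong : ∀ {c c′ S} → (∀ {u} → u ∈ S → c u ≡ c′ u) → Good c S → Good c′ S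
  Good-cong eq (proper , pos , cert) =
    (λ u∈ v∈ u~v c′u≡c′v → proper u∈ v∈ u~v (trans (eq u∈) (trans c′u≡c′v (sym (eq v∈))))) ,
    pos , record { injective = injective
                 ; paired    = λ u∈ v∈ same →
                     [ (λ cu≡cv → inj₁ (trans (sym (eq u∈)) (trans cu≡cv (eq v∈)))) , inj₂ ]′ (paired u∈ v∈ same) }
    where open Certificate cert

  Good-∪ : ∀ {c S v} → Good c S → v ∉ S → ∣ S ∣ < m * 2 → ∃[ x ] Good (c [ v ↦ x ]) (S ∪ ⁅ v ⁆)
  Good-∪ {c} {S} {v} (proper , pos₀ , cert₀) v∉S room = x , proper′ , pos′ , record { injective = inj ; paired = pair }
    where
    free₀ = free-position G tf m pos₀ room
    placed : Placeable G tf m c S v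
    placed = place G tf m v pos₀ (allFin m) _ ℕ.≤-refl cert₀ (λ _ _ _ _ → ∈-allFin _) (proj₁ free₀) (proj₂ free₀)
    pos = proj₁ placed
    π = proj₁ (proj₂ placed)
    x = proj₁ (proj₂ (proj₂ placed))
    cert = proj₁ (proj₂ (proj₂ (proj₂ placed)))
    free = proj₁ (proj₂ (proj₂ (proj₂ (proj₂ placed))))
    unused = proj₁ (proj₂ (proj₂ (proj₂ (proj₂ (proj₂ placed)))))
    fits = proj₂ (proj₂ (proj₂ (proj₂ (proj₂ (proj₂ placed)))))
    open Certificate cert
    c′ = c [ v ↦ x ]
    pos′ = pos [ v ↦ π ]

    c-old : ∀ {u} → u ≢ v → c′ u ≡ c u
    c-old = ↦-other c v
    c-new : c′ v ≡ x
    c-new = ↦-same c v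
    pos-old : ∀ {u} → u ≢ v → pos′ u ≡ pos u
    pos-old = ↦-other pos v
    pos-new : pos′ v ≡ π
    pos-new = ↦-same pos v

    proper′ : ProperOn G tf m c′ (S ∪ ⁅ v ⁆)
    proper′ {u} {w} u∈ w∈ u~w eq with u ≟ v | w ≟ v
    ... | yes refl | yes refl = ~-irr refl u~w
    ... | yes refl | no w≢v   = unused (∪-singleton⁻ w∈ w≢v) u~w (trans (sym (c-old w≢v)) (trans (sym eq) c-new))
    ... | no u≢v   | yes refl = unused (∪-singleton⁻ u∈ u≢v) (~-sym u~w) (trans (sym (c-old u≢v)) (trans eq c-new))
    ... | no u≢v   | no w≢v   =
      proper (∪-singleton⁻ u∈ u≢v) (∪-singleton⁻ w∈ w≢v) u~w (trans (sym (c-old u≢v)) (trans eq (c-old w≢v)))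

    inj : ∀ {u w} → u ∈ S ∪ ⁅ v ⁆ → w ∈ S ∪ ⁅ v ⁆ → pos′ u ≡ pos′ w → u ≡ w
    inj {u} {w} u∈ w∈ eq with u ≟ v | w ≟ v
    ... | yes refl | yes refl = refl
    ... | yes refl | no w≢v   =
      contradiction (trans (sym (pos-old w≢v)) (trans (sym eq) pos-new)) (free (∪-singleton⁻ w∈ w≢v))
    ... | no u≢v   | yes refl =
      contradiction (trans (sym (pos-old u≢v)) (trans eq pos-new)) (free (∪-singleton⁻ u∈ u≢v))
    ... | no u≢v   | no w≢v   =
      injective (∪-singleton⁻ u∈ u≢v) (∪-singleton⁻ w∈ w≢v) (trans (sym (pos-old u≢v)) (trans eq (pos-old w≢v)))

    beside-v : ∀ {u} → u ∈ S ∪ ⁅ v ⁆ → u ≢ v → proj₁ (pos′ u) ≡ proj₁ (pos′ v) → c′ u ≡ c′ v ⊎ v ~ u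
    beside-v u∈ u≢v eq =
      [ (λ cu≡x → inj₁ (trans (c-old u≢v) (trans cu≡x (sym c-new)))) , inj₂ ]′
      (fits (∪-singleton⁻ u∈ u≢v) (trans (cong proj₁ (sym (pos-old u≢v))) (trans eq (cong proj₁ pos-new))))

    pair : ∀ {u w} → u ∈ S ∪ ⁅ v ⁆ → w ∈ S ∪ ⁅ v ⁆ → proj₁ (pos′ u) ≡ proj₁ (pos′ w) → c′ u ≡ c′ w ⊎ u ~ w
    pair {u} {w} u∈ w∈ eq with u ≟ v | w ≟ v
    ... | yes refl | yes refl = inj₁ refl
    ... | yes refl | no w≢v   = [ inj₁ ∘ sym , inj₂ ]′ (beside-v w∈ w≢v (sym eq))
    ... | no u≢v   | yes refl = [ inj₁ , inj₂ ∘ ~-sym ]′ (beside-v u∈ u≢v eq)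
    ... | no u≢v   | no w≢v   =
      [ (λ cu≡cw → inj₁ (trans (c-old u≢v) (trans cu≡cw (sym (c-old w≢v))))) , inj₂ ]′
      (paired (∪-singleton⁻ u∈ u≢v) (∪-singleton⁻ w∈ w≢v)
        (trans (cong proj₁ (sym (pos-old u≢v))) (trans eq (cong proj₁ (pos-old w≢v)))))

  -- The final agreement clause is what protects earlier bags: colours change only on `B` outside
  -- the part `S` already coloured.
  Good-fill : ∀ {B} → ∣ B ∣ ≤ m * 2 → ∀ xs {c S} → S ⊆ B → Good c S →
    ∃₂ λ c′ S′ → (∀ {u} → u ∈ˡ xs → u ∈ B → u ∈ S′) × S ⊆ S′ × Good c′ S′ ×
      (∀ {u} → u ∉ B ⊎ u ∈ S → c′ u ≡ c u)
  Good-fill ∣B∣≤2m [] {c} {S} S⊆B good = c , S , (λ ()) , (λ u∈ → u∈) , good , λ _ → refl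
  Good-fill {B} ∣B∣≤2m (x ∷ xs) {c} {S} S⊆B good with x ∈? B | x ∈? S
  ... | no x∉B | _ =
    let c′ , S′ , filled , S⊆S′ , good′ , agree = Good-fill ∣B∣≤2m xs S⊆B good
    in c′ , S′ , (λ { (here refl) x∈B → contradiction x∈B x∉B ; (there u∈) → filled u∈ }) , S⊆S′ , good′ , agree
  ... | yes _ | yes x∈S =
    let c′ , S′ , filled , S⊆S′ , good′ , agree = Good-fill ∣B∣≤2m xs S⊆B good
    in c′ , S′ , (λ { (here refl) _ → S⊆S′ x∈S ; (there u∈) → filled u∈ }) , S⊆S′ , good′ , agree
  ... | yes x∈B | no x∉S =
    -- `x` lies in `B` but not in `S`, so `S` has fewer than `m * 2` vertices and a position is
    -- free.
    let y , good₁ = Good-∪ good x∉S (ℕ.<-≤-trans (p⊂q⇒∣p∣<∣q∣ (S⊆B , x , x∈B , x∉S)) ∣B∣≤2m)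
        S∪x⊆B : S ∪ ⁅ x ⁆ ⊆ B
        S∪x⊆B = λ u∈ → [ S⊆B , (λ u∈x → subst (_∈ B) (sym (x∈⁅y⁆⇒x≡y x u∈x)) x∈B) ]′ (x∈p∪q⁻ S ⁅ x ⁆ u∈)
        c′ , S′ , filled , S∪x⊆S′ , good′ , agree = Good-fill ∣B∣≤2m xs S∪x⊆B good₁
    in c′ , S′ ,
       (λ { (here refl) _ → S∪x⊆S′ (q⊆p∪q S ⁅ x ⁆ (x∈⁅x⁆ x)) ; (there u∈) → filled u∈ }) ,
       S∪x⊆S′ ∘ p⊆p∪q ⁅ x ⁆ , good′ ,
       λ { (inj₁ u∉B) → trans (agree (inj₁ u∉B)) (↦-other c x λ { refl → u∉B x∈B })
         ; (inj₂ u∈S) → trans (agree (inj₂ (p⊆p∪q ⁅ x ⁆ u∈S))) (↦-other c x λ { refl → x∉S u∈S }) }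

-- Traversing the tree

module _ {n : ℕ} (R : Rel (Fin n) 0ℓ) where
  open DecList (_≟_ {n}) using () renaming (_∈?_ to _∈ᶠ?_)

  -- The list omits the starting vertex, so that `x ∷ vs` is the whole vertex sequence.
  data SimplePath : Fin n → Fin n → List (Fin n) → Set where
    stop : ∀ {x} → SimplePath x x []
    step : ∀ {x z y vs} → R x z → x ∉ˡ z ∷ vs → SimplePath z y vs → SimplePath x y (z ∷ vs)

  suffix-from : ∀ {x z y vs} → x ∈ˡ z ∷ vs → SimplePath z y vs → ∃ (SimplePath x y)
  suffix-from (here refl) path             = _ , path
  suffix-from (there x∈)  (step _ _ path)  = suffix-from x∈ path

  -- Loop erasure: if the simplified rest of the walk returns to `x`, only the part from that return
  -- on is kept.
  simplify : ∀ {x y} → Star R x y → ∃ (SimplePath x y)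
  simplify ε = [] , stop
  simplify {x} (xRz ◅ walk) with simplify walk
  ... | vs , path with x ∈ᶠ? (_ ∷ vs)
  ... | yes x∈ = suffix-from x∈ path
  ... | no x∉  = _ , step xRz x∉ path

  simple-unique : ∀ {x y vs} → SimplePath x y vs → Unique (x ∷ vs)
  simple-unique stop             = [] ∷ []
  simple-unique (step _ x∉ path) = All.¬Any⇒All¬ _ x∉ ∷ simple-unique path

  simple-linked : ∀ {Q : Rel (Fin n) 0ℓ} {x y w vs} → (∀ {u v} → R u v → Q u v) → Q y w →
    SimplePath x y vs → Linked Q (x ∷ vs ++ [ w ])
  simple-linked R⇒Q yQw stop              = yQw ∷ [-]
  simple-linked R⇒Q yQw (step xRz _ path) = R⇒Q xRz ∷ simple-linked R⇒Q yQw path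

module _ (T : Graph) (acyclic : ∀ vs → ¬ IsCycle T vs) where
  open Graph T

  -- Adjacency in `T` with the edge between `t` and `p` deleted.
  Avoids : Vertex → Vertex → Rel Vertex 0ℓ
  Avoids t p x y = x ~ y × ¬ (x ≡ t × y ≡ p) × ¬ (x ≡ p × y ≡ t)

  -- A simple path avoiding the edge would be closed by it to a cycle. Paths with fewer than two
  -- edges, too short for that, are excluded directly.
  edge-is-bridge : ∀ {t p} → t ~ p → ¬ Star (Avoids t p) t p
  edge-is-bridge {t} {p} t~p walk with simplify _ walk
  ... | []         , stop = ~-irr refl t~p
  ... | _ ∷ []     , step (_ , ¬tp , _) _ stop = ¬tp (refl , refl)
  ... | u ∷ v ∷ vs , path = acyclic (t ∷ u ∷ v ∷ vs)
    (s≤s (s≤s z≤n) , simple-unique _ path , simple-linked _ proj₁ (~-sym t~p) path)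

  inside : ∀ {t p} {P : Subset order} → t ∉ P →
    (∀ {u v} → u ∈ P → v ∈ P → Star (Induced T (_∈ P)) u v) →
    ∀ {u v} → u ∈ P → v ∈ P → Star (Avoids t p) u v
  inside t∉P conn u∈ v∈ =
    Star.map (λ (x∈ , y∈ , x~y) → x~y , (λ { (refl , _) → t∉P x∈ }) , (λ { (_ , refl) → t∉P y∈ })) (conn u∈ v∈)

  -- Walking inside Q from t outside P to some vertex of P must use the edge from
  -- t to p, since another way into P would avoid that bridge.
  enters-through : ∀ {t p} {P : Subset order} {Q : Vertex → Set} → t ~ p → t ∉ P → p ∈ P →
    (∀ {u v} → u ∈ P → v ∈ P → Star (Induced T (_∈ P)) u v) →
    ∀ {x s} → Star (Avoids t p) t x → x ∉ P → Star (Induced T Q) x s → s ∈ P → Q p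
  enters-through t~p t∉P p∈P conn before x∉P ε s∈P = contradiction s∈P x∉P
  enters-through {t} {p} {P} t~p t∉P p∈P conn {x} before x∉P (_◅_ {j = y} (_ , Qy , x~y) walk) s∈P
    with y ∈? P | x ≟ t | y ≟ p
  ... | no y∉P | _ | _ = enters-through t~p t∉P p∈P conn
    (before ◅◅ (x~y , (λ { (_ , refl) → y∉P p∈P }) , (λ { (refl , _) → x∉P p∈P })) ◅ ε) y∉P walk s∈P
  ... | yes _   | yes refl | yes refl = Qy
  ... | yes y∈P | yes refl | no y≢p   = ⊥-elim (edge-is-bridge t~p
    (before ◅◅ (x~y , (λ (_ , y≡p) → y≢p y≡p) , (λ { (refl , _) → x∉P p∈P })) ◅ inside t∉P conn y∈P p∈P))
  ... | yes y∈P | no x≢t   | _        = ⊥-elim (edge-is-bridge t~p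
    (before ◅◅ (x~y , (λ (x≡t , _) → x≢t x≡t) , (λ { (refl , _) → x∉P p∈P })) ◅ inside t∉P conn y∈P p∈P))

module _ (G : Graph) (tf : TriangleFree G) (m : ℕ) (D : TreeDecomposition G) where
  open Graph G
  open TreeDecomposition D
  open Graph tree using () renaming (order to treeOrder; _~_ to _~ᵗ_; ~-sym to ~ᵗ-sym; ~-irr to ~ᵗ-irr; Vertex to Node)

  -- `colour` is total, but controlled only on the bags of `P`. `P` stays connected so that a walk
  -- from a new node into `P` has to use the edge that attaches this node.
  record PartialColouring (P : Subset treeOrder) : Set where
    field
      colour    : Colouring G (suc m)
      good      : ∀ {t} → t ∈ P → Good G tf m colour (bag t)
      joined    : ∀ {s t} → s ∈ P → t ∈ P → Star (Induced tree (_∈ P)) s t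

  open PartialColouring

  module _ (∣bag∣≤2m : ∀ t → ∣ bag t ∣ ≤ m * 2) where

    colour-bag : ∀ t {S c} → S ⊆ bag t → Good G tf m c S →
      ∃[ c′ ] (Good G tf m c′ (bag t) × (∀ {u} → u ∉ bag t ⊎ u ∈ S → c′ u ≡ c u))
    colour-bag t S⊆ good =
      let c′ , S′ , filled , _ , good′ , agree = Good-fill G tf m (∣bag∣≤2m t) (allFin order) S⊆ good
      in c′ , Good-⊆ G tf m (λ u∈ → filled (∈-allFin _) u∈) good′ , agree

    -- The colours on the separator `bag t ∩ bag p` are kept and extended to the rest of `bag t`,
    -- whose vertices occur in no bag of `P`.
    add-node : ∀ {P p t} → PartialColouring P → p ∈ P → t ∉ P → t ~ᵗ p → PartialColouring (P ∪ ⁅ t ⁆)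
    add-node {P} {p} {t} pc p∈P t∉P t~p = record { colour = c′ ; good = good′ ; joined = joined′ }
      where
      separator = bag t ∩ bag p
      coloured = colour-bag t {separator} {colour pc} (p∩q⊆p (bag t) (bag p))
        (Good-⊆ G tf m (p∩q⊆q (bag t) (bag p)) (good pc p∈P))
      c′ = proj₁ coloured

      agree : ∀ {s u} → s ∈ P → u ∈ bag s → colour pc u ≡ c′ u
      agree {s} {u} s∈P u∈s with u ∈? bag t
      ... | no u∉t  = sym (proj₂ (proj₂ coloured) (inj₁ u∉t))
      -- The nodes whose bags contain `u` are connected, and both `t` and `s` are among them. A walk
      -- between them inside this set passes through `p`, so `u` is in the separator.
      ... | yes u∈t = sym (proj₂ (proj₂ coloured) (inj₂ (x∈p∩q⁺ (u∈t ,
        enters-through tree (proj₂ isTree) {Q = λ n → u ∈ bag n} t~p t∉P p∈P (joined pc) ε t∉P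
          (proj₂ (connected u) u∈t u∈s) s∈P))))

      good′ : ∀ {s} → s ∈ P ∪ ⁅ t ⁆ → Good G tf m c′ (bag s)
      good′ {s} s∈ with s ≟ t
      ... | yes refl = proj₁ (proj₂ coloured)
      ... | no s≢t   = let s∈P = ∪-singleton⁻ s∈ s≢t in Good-cong G tf m (agree s∈P) (good pc s∈P)

      old : ∀ {s} → s ∈ P → s ∈ P ∪ ⁅ t ⁆
      old = p⊆p∪q ⁅ t ⁆

      t∈ : t ∈ P ∪ ⁅ t ⁆
      t∈ = q⊆p∪q P ⁅ t ⁆ (x∈⁅x⁆ t)

      joined-old : ∀ {s r} → s ∈ P → r ∈ P → Star (Induced tree (_∈ P ∪ ⁅ t ⁆)) s r
      joined-old s∈ r∈ = Star.map (λ (x∈ , y∈ , x~y) → old x∈ , old y∈ , x~y) (joined pc s∈ r∈)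

      joined′ : ∀ {s r} → s ∈ P ∪ ⁅ t ⁆ → r ∈ P ∪ ⁅ t ⁆ → Star (Induced tree (_∈ P ∪ ⁅ t ⁆)) s r
      joined′ {s} {r} s∈ r∈ with s ≟ t | r ≟ t
      ... | yes refl | yes refl = ε
      ... | yes refl | no r≢t   = (t∈ , old p∈P , t~p) ◅ joined-old p∈P (∪-singleton⁻ r∈ r≢t)
      ... | no s≢t   | yes refl = joined-old (∪-singleton⁻ s∈ s≢t) p∈P ◅◅ (old p∈P , t∈ , ~ᵗ-sym t~p) ◅ ε
      ... | no s≢t   | no r≢t   = joined-old (∪-singleton⁻ s∈ s≢t) (∪-singleton⁻ r∈ r≢t)

    reach-node : ∀ {P p s} → PartialColouring P → p ∈ P → Star _~ᵗ_ p s →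
      ∃[ P′ ] (PartialColouring P′ × P ⊆ P′ × s ∈ P′)
    reach-node pc p∈P ε = _ , pc , (λ u∈ → u∈) , p∈P
    reach-node {P} pc p∈P (_◅_ {j = t} p~t walk) with t ∈? P
    ... | yes t∈P = reach-node pc t∈P walk
    ... | no t∉P  =
      let P′ , pc′ , P∪t⊆P′ , s∈P′ = reach-node (add-node pc p∈P t∉P (~ᵗ-sym p~t)) (q⊆p∪q P ⁅ t ⁆ (x∈⁅x⁆ t)) walk
      in P′ , pc′ , P∪t⊆P′ ∘ p⊆p∪q ⁅ t ⁆ , s∈P′

    reach-nodes : ∀ {P p} → PartialColouring P → p ∈ P → ∀ ts →
      ∃[ P′ ] (PartialColouring P′ × P ⊆ P′ × All (_∈ P′) ts)
    reach-nodes pc p∈P [] = _ , pc , (λ u∈ → u∈) , []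
    reach-nodes {p = p} pc p∈P (t ∷ ts) =
      let P₁ , pc₁ , P⊆P₁ , ts∈ = reach-nodes pc p∈P ts
          P₂ , pc₂ , P₁⊆P₂ , t∈ = reach-node pc₁ (P⊆P₁ p∈P) (Star.map (proj₂ ∘ proj₂) (proj₂ (proj₁ isTree) {p} {t} _ _))
      in P₂ , pc₂ , P₁⊆P₂ ∘ P⊆P₁ , t∈ ∷ All.map P₁⊆P₂ ts∈

    -- Once every node is reached, the colouring is proper on each bag, and every edge lies in a
    -- bag.
    proper-colouring : Fin m → ∃[ c ] Proper G {suc m} c
    proper-colouring σ₀ = colour all , λ u~v →
      let t , u∈t , v∈t = edge-bag u~v
      in proj₁ (good all (All.lookup (proj₂ (proj₂ (proj₂ reached))) (∈-allFin t))) u∈t v∈t u~v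
      where
      root = proj₁ (proj₁ (proj₁ isTree))

      -- On the empty set any placement will do; `σ₀` provides a value for a constant one.
      none : Good G tf m (const zero) ∅
      none = (λ u∈ → contradiction u∈ ∉⊥) , const (σ₀ , zero) ,
        record { injective = λ u∈ → contradiction u∈ ∉⊥ ; paired = λ u∈ → contradiction u∈ ∉⊥ }

      coloured = colour-bag root {∅} (λ u∈ → contradiction u∈ ∉⊥) none

      at-root : ∀ {t} → t ∈ ⁅ root ⁆ → t ≡ root
      at-root = x∈⁅y⁆⇒x≡y root

      start : PartialColouring ⁅ root ⁆
      start = record
        { colour = proj₁ coloured
        ; good   = λ t∈ → subst (λ t → Good G tf m (proj₁ coloured) (bag t)) (sym (at-root t∈)) (proj₁ (proj₂ coloured))
        ; joined = λ s∈ t∈ → subst (Star _ _) (trans (at-root s∈) (sym (at-root t∈))) ε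
        }

      reached = reach-nodes start (x∈⁅x⁆ root) (allFin treeOrder)
      all = proj₁ (proj₂ reached)

colourable : ∀ {k G} m → suc k ≤ m * 2 → 1 ≤ m → TriangleFreeTreewidthAtMost k G →
  ∃[ c ] Proper G {suc m} c
colourable {k} {G} (suc m) k<2m _ (tf , D , width≤k) = proper-colouring G tf (suc m) D bag-size zero
  where
  open TreeDecomposition D
  bag-size : ∀ t → ∣ bag t ∣ ≤ suc m * 2
  bag-size t = ℕ.≤-trans
    (All.lookup (xs≤max 0 (map (∣_∣ ∘ bag) (allFin (Graph.order tree)))) (∈-map⁺ _ (∈-allFin t)))
    -- This undoes the truncated subtraction in `width`: the largest bag has at most `1 + width`
    -- vertices.
    (ℕ.≤-trans (ℕ.m≤n+m∸n _ 1) (ℕ.≤-trans (s≤s width≤k) k<2m))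

-- Monochromatic components

module _ {n : ℕ} {P : Pred (Fin n) 0ℓ} (P? : Decidable P) where

  subset : Subset n
  subset = Vec.tabulate (does ∘ P?)

  ∈-subset⁺ : ∀ {x} → P x → x ∈ subset
  ∈-subset⁺ {x} px = lookup⇒[]= x subset (trans (lookup∘tabulate _ x) (dec-true (P? x) px))

  ∈-subset⁻ : ∀ {x} → x ∈ subset → P x
  ∈-subset⁻ {x} x∈ with P? x | trans (sym (lookup∘tabulate (does ∘ P?) x)) ([]=⇒lookup x∈)
  ... | yes px | _ = px
  ... | no _   | ()

module _ (G : Graph) where
  open Graph G

  maxDegree≤ : ∀ {C s} → (∀ {v} → v ∈ C → degreeIn G C v ≤ s) → maxDegree G C ≤ s
  maxDegree≤ {C} bound = max≤v⁺ z≤n (All.map⁺ (All.map bound (All.all-filter (_∈? C) (allFin order))))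

  degree≤maxDegree : ∀ {C v} → v ∈ C → degreeIn G C v ≤ maxDegree G C
  degree≤maxDegree {C} {v} v∈C = All.lookup (xs≤max 0 _) (∈-map⁺ (degreeIn G C) (∈-filter⁺ (_∈? C) (∈-allFin v) v∈C))

  module _ {k : ℕ} {c : Colouring G k} where

    clustering⇒defect : ∀ {s} → HasClustering G c s → HasDefect G c s
    clustering⇒defect clustered C comp =
      maxDegree≤ {C} λ {v} _ → ℕ.≤-trans (∣p∩q∣≤∣q∣ (neighbours v) C) (clustered C comp)

    -- The first edge of a walk inside `C` would join two vertices of one colour.
    proper⇒trivial-component : Proper G c → ∀ {C} → IsMonochromaticComponent G c C →
      ∀ {u v} → u ∈ C → v ∈ C → u ≡ v
    proper⇒trivial-component proper {C} (_ , mono , (_ , walk) , _) u∈ v∈ with walk u∈ v∈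
    ... | ε                      = refl
    ... | (_ , w∈ , u~w) ◅ _ = contradiction (trans (mono u∈) (sym (mono w∈))) (proper u~w)

    proper⇒clustering : Proper G c → HasClustering G c 1
    proper⇒clustering proper C comp@(_ , _ , ((x , x∈) , _) , _) =
      subst (∣ C ∣ ≤_) (∣⁅x⁆∣≡1 x) $ p⊆q⇒∣p∣≤∣q∣ λ {y} y∈ →
        subst (_∈ ⁅ x ⁆) (proper⇒trivial-component proper comp x∈ y∈) (x∈⁅x⁆ x)

    proper⇒defect : Proper G c → HasDefect G c 0
    proper⇒defect proper C comp = maxDegree≤ {C} λ {v} v∈ →
      subst (degreeIn G C v ≤_) (∣⊥∣≡0 order) $ p⊆q⇒∣p∣≤∣q∣ {q = ∅} λ {u} u∈ →
        let u∈N , u∈C = x∈p∩q⁻ (neighbours v) C u∈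
        in contradiction (∈-subset⁻ (v ~?_) u∈N) (~-irr (proper⇒trivial-component proper comp v∈ u∈C))

  -- While the set is not maximal, a strictly larger connected one replaces it; `fuel` bounds the
  -- number of vertices outside. The double negation avoids having to decide whether a larger set
  -- exists, and it can be removed wherever the goal is decidable.
  ¬¬extends-to-component : ∀ {P : Pred Vertex 0ℓ} fuel C → order ≤ ∣ C ∣ + fuel →
    (∀ {v} → v ∈ C → P v) → Connected G (_∈ C) → ¬ ¬ (∃[ C′ ] (C ⊆ C′ × IsComponent G P C′))
  ¬¬extends-to-component {P} fuel C room C⊆P conn none = none (C , (λ u∈ → u∈) , C⊆P , conn , maximal)
    where
    larger : ∀ fuel → order ≤ ∣ C ∣ + fuel → ∀ D → C ⊆ D → (∀ {v} → v ∈ D → P v) → Connected G (_∈ D) →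
      ∀ {x} → x ∈ D → x ∉ C → ⊥
    larger zero       room D C⊆D _ _ x∈D x∉C = ℕ.<⇒≱ (p⊂q⇒∣p∣<∣q∣ (C⊆D , _ , x∈D , x∉C))
      (ℕ.≤-trans (∣p∣≤n D) (subst (order ≤_) (ℕ.+-identityʳ _) room))
    larger (suc fuel) room D C⊆D D⊆P connD x∈D x∉C = ¬¬extends-to-component fuel D
      (ℕ.≤-trans (subst (order ≤_) (ℕ.+-suc _ _) room) (ℕ.+-monoˡ-≤ fuel (p⊂q⇒∣p∣<∣q∣ (C⊆D , _ , x∈D , x∉C))))
      D⊆P connD λ (C′ , D⊆C′ , comp) → none (C′ , D⊆C′ ∘ C⊆D , comp)

    maximal : ∀ D → C ⊆ D → (∀ {v} → v ∈ D → P v) → Connected G (_∈ D) → D ⊆ C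
    maximal D C⊆D D⊆P connD {x} x∈D = decidable-stable (x ∈? C) λ x∉C → larger fuel room D C⊆D D⊆P connD x∈D x∉C

  -- `u` and its neighbours of the same colour induce a connected set, hence lie in one
  -- monochromatic component, where the degree of `u` is at least `length ys`.
  defect⇒few-neighbours : ∀ {k d} {c : Colouring G k} → HasDefect G c d →
    ∀ u {ys} → Unique ys → All (λ y → u ~ y × c y ≡ c u) ys → length ys ≤ d
  defect⇒few-neighbours {d = d} {c} defect u {ys} unique near = decidable-stable (length ys ≤? d) λ ys≰d →
    ¬¬extends-to-component order star (ℕ.m≤n+m order _) mono ((u , centre) , joined) λ (C , star⊆C , comp) →
      ys≰d (begin
        length ys         ≤⟨ length-unique≤ unique (All.map (λ (u~y , same) →
                               x∈p∩q⁺ (∈-subset⁺ (u ~?_) u~y , star⊆C (∈-subset⁺ InStar? (inj₂ (u~y , same))))) near) ⟩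
        degreeIn G C u    ≤⟨ degree≤maxDegree (star⊆C centre) ⟩
        maxDegree G C     ≤⟨ defect C (c u , comp) ⟩
        d                 ∎)
    where
    open ℕ.≤-Reasoning
    InStar : Pred Vertex 0ℓ
    InStar y = y ≡ u ⊎ (u ~ y × c y ≡ c u)

    InStar? : Decidable InStar
    InStar? y = (y ≟ u) ⊎-dec ((u ~? y) ×-dec (c y ≟ c u))

    star : Subset order
    star = subset InStar?

    centre : u ∈ star
    centre = ∈-subset⁺ InStar? (inj₁ refl)

    mono : ∀ {y} → y ∈ star → c y ≡ c u
    mono y∈ with ∈-subset⁻ InStar? y∈
    ... | inj₁ refl       = refl
    ... | inj₂ (_ , same) = same

    out : ∀ {y} → y ∈ star → Star (Induced G (_∈ star)) u y
    out y∈ with ∈-subset⁻ InStar? y∈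
    ... | inj₁ refl      = ε
    ... | inj₂ (u~y , _) = (centre , y∈ , u~y) ◅ ε

    back : ∀ {y} → y ∈ star → Star (Induced G (_∈ star)) y u
    back y∈ with ∈-subset⁻ InStar? y∈
    ... | inj₁ refl      = ε
    ... | inj₂ (u~y , _) = (y∈ , centre , ~-sym u~y) ◅ ε

    joined : ∀ {x y} → x ∈ star → y ∈ star → Star (Induced G (_∈ star)) x y
    joined x∈ y∈ = back x∈ ◅◅ out y∈

-- Graphs grown one vertex at a time

module _ {A : Set} where

  _[_≔_] : (ℕ → A) → ℕ → A → ℕ → A
  (f [ n ≔ a ]) l with l ℕ.≟ n
  ... | yes _ = a
  ... | no _  = f l

  ≔-same : ∀ f n {a} → (f [ n ≔ a ]) n ≡ a
  ≔-same f n with n ℕ.≟ n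
  ... | yes _  = refl
  ... | no n≢n = contradiction refl n≢n

  ≔-below : ∀ f {n a l} → l < n → (f [ n ≔ a ]) l ≡ f l
  ≔-below f {n} {l = l} l<n with l ℕ.≟ n
  ... | yes refl = contradiction l<n (ℕ.<-irrefl refl)
  ... | no _     = refl

-- A graph built by adding the vertices 0, 1, 2, … in turn, together with a tree
-- decomposition.  Node 0 is the root, with empty bag; adding vertex l adds node
-- suc l as a child of parent l, with the vertices of keep l and l itself in its bag.
record Scheme : Set where
  field
    size   : ℕ
    parent : ℕ → ℕ
    keep   : ℕ → List ℕ
    back   : ℕ → List ℕ

open Scheme

bag : Scheme → ℕ → List ℕ
bag S zero    = []
bag S (suc l) = l ∷ keep S l

Adj : Scheme → ℕ → ℕ → Set
Adj S u v = u ∈ˡ back S v ⊎ v ∈ˡ back S u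

Independent : Scheme → List ℕ → Set
Independent S L = ∀ {u v} → u ∈ˡ L → v ∈ˡ L → ¬ Adj S u v

-- `keep⊆` will give connected sets of bags, `∣keep∣≤k` the width, `back⊆` edges inside bags, and
-- `independent` the absence of triangles. The child in `parent≤` is node `suc l`, so `≤` does put
-- the parent earlier.
record Valid (k : ℕ) (S : Scheme) : Set where
  field
    parent≤     : ∀ {l} → l < size S → parent S l ≤ l
    keep⊆       : ∀ {l} → l < size S → keep S l ⊆ˡ bag S (parent S l)
    ∣keep∣≤k    : ∀ {l} → l < size S → length (keep S l) ≤ k
    back⊆       : ∀ {l} → l < size S → back S l ⊆ˡ keep S l
    independent : ∀ {l} → l < size S → Independent S (back S l)

module _ {k S} (valid : Valid k S) where
  open Valid valid

  -- A vertex kept at node `suc l` comes from the bag of the parent, an earlier node; `b` bounds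
  -- this climb.
  ∈-bag⇒< : ∀ b {t u} → t ≤ b → t ≤ size S → u ∈ˡ bag S t → u < t
  ∈-bag⇒< (suc b) {suc l} (s≤s l≤b) l<n (here refl) = ℕ.≤-refl
  ∈-bag⇒< (suc b) {suc l} (s≤s l≤b) l<n (there u∈)  =
    ℕ.m≤n⇒m≤1+n (ℕ.<-≤-trans
      (∈-bag⇒< b (ℕ.≤-trans (parent≤ l<n) l≤b) (ℕ.≤-trans (parent≤ l<n) (ℕ.<⇒≤ l<n)) (keep⊆ l<n u∈))
      (parent≤ l<n))

  ∈-bag⇒<size : ∀ {t u} → t ≤ size S → u ∈ˡ bag S t → u < size S
  ∈-bag⇒<size t≤n u∈ = ℕ.<-≤-trans (∈-bag⇒< _ ℕ.≤-refl t≤n u∈) t≤n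

  ∈-back⇒< : ∀ {l u} → l < size S → u ∈ˡ back S l → u < l
  ∈-back⇒< l<n u∈ = ℕ.<-≤-trans
    (∈-bag⇒< _ ℕ.≤-refl (ℕ.≤-trans (parent≤ l<n) (ℕ.<⇒≤ l<n)) (keep⊆ l<n (back⊆ l<n u∈))) (parent≤ l<n)

  Adj-irrefl : ∀ {u} → u < size S → ¬ Adj S u u
  Adj-irrefl u<n = [ irr , irr ]′
    where irr = λ u∈ → ℕ.<-irrefl refl (∈-back⇒< u<n u∈)

infix 4 _⊑_
-- Agreement is asked only below `size S`, since the data of a scheme are arbitrary from there on.
record _⊑_ (S S′ : Scheme) : Set where
  field
    size≤   : size S ≤ size S′
    parent≡ : ∀ {l} → l < size S → parent S′ l ≡ parent S l
    keep≡   : ∀ {l} → l < size S → keep S′ l ≡ keep S l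
    back≡   : ∀ {l} → l < size S → back S′ l ≡ back S l

⊑-refl : ∀ {S} → S ⊑ S
⊑-refl = record { size≤ = ℕ.≤-refl ; parent≡ = λ _ → refl ; keep≡ = λ _ → refl ; back≡ = λ _ → refl }

⊑-trans : ∀ {S S′ S″} → S ⊑ S′ → S′ ⊑ S″ → S ⊑ S″
⊑-trans e e′ = record
  { size≤   = ℕ.≤-trans E.size≤ E′.size≤
  ; parent≡ = λ l< → trans (E′.parent≡ (ℕ.<-≤-trans l< E.size≤)) (E.parent≡ l<)
  ; keep≡   = λ l< → trans (E′.keep≡ (ℕ.<-≤-trans l< E.size≤)) (E.keep≡ l<)
  ; back≡   = λ l< → trans (E′.back≡ (ℕ.<-≤-trans l< E.size≤)) (E.back≡ l<)
  }
  where module E = _⊑_ e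
        module E′ = _⊑_ e′

module _ {S S′} (S⊑S′ : S ⊑ S′) where
  open _⊑_ S⊑S′

  bag-≡ : ∀ {t} → t ≤ size S → bag S′ t ≡ bag S t
  bag-≡ {zero}  _   = refl
  bag-≡ {suc l} l<n = cong (l ∷_) (keep≡ l<n)

  Adj-extend : ∀ {u v} → u < size S → v < size S → Adj S u v → Adj S′ u v
  Adj-extend u<n v<n (inj₁ u∈) = inj₁ (subst (_ ∈ˡ_) (sym (back≡ v<n)) u∈)
  Adj-extend u<n v<n (inj₂ v∈) = inj₂ (subst (_ ∈ˡ_) (sym (back≡ u<n)) v∈)

  Adj-restrict : ∀ {u v} → u < size S → v < size S → Adj S′ u v → Adj S u v
  Adj-restrict u<n v<n (inj₁ u∈) = inj₁ (subst (_ ∈ˡ_) (back≡ v<n) u∈)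
  Adj-restrict u<n v<n (inj₂ v∈) = inj₂ (subst (_ ∈ˡ_) (back≡ u<n) v∈)

  Independent-extend : ∀ {L} → (∀ {u} → u ∈ˡ L → u < size S) → Independent S L → Independent S′ L
  Independent-extend L<n ind u∈ v∈ adj = ind u∈ v∈ (Adj-restrict (L<n u∈) (L<n v∈) adj)

push : Scheme → ℕ → List ℕ → List ℕ → Scheme
push S t K N = record
  { size   = suc (size S)
  ; parent = parent S [ size S ≔ t ]
  ; keep   = keep S [ size S ≔ K ]
  ; back   = back S [ size S ≔ N ]
  }

⊑-push : ∀ S {t K N} → S ⊑ push S t K N
⊑-push S = record
  { size≤   = ℕ.n≤1+n _
  ; parent≡ = ≔-below (parent S)
  ; keep≡   = ≔-below (keep S)
  ; back≡   = ≔-below (back S)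
  }

bag-push : ∀ S {t K N} → bag (push S t K N) (suc (size S)) ≡ size S ∷ K
bag-push S = cong (size S ∷_) (≔-same (keep S) (size S))

Adj-push : ∀ S {t K N u} → u ∈ˡ N → Adj (push S t K N) u (size S)
Adj-push S {N = N} u∈ = inj₁ (subst (_ ∈ˡ_) (sym (≔-same (back S) (size S))) u∈)

Adj-push⁻ : ∀ {k S t K N u} → Valid k S → u < size S → Adj (push S t K N) u (size S) → u ∈ˡ N
Adj-push⁻ {S = S} valid u<n (inj₁ u∈) = subst (_ ∈ˡ_) (≔-same (back S) (size S)) u∈
Adj-push⁻ {S = S} valid u<n (inj₂ n∈) = contradiction
  (∈-back⇒< valid u<n (subst (_ ∈ˡ_) (≔-below (back S) u<n) n∈)) (ℕ.<-asym u<n)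

-- The conditions under which `push S t K N` is again valid.
record Site (k : ℕ) (S : Scheme) (t : ℕ) (K N : List ℕ) : Set where
  field
    t≤size : t ≤ size S
    K⊆bag  : K ⊆ˡ bag S t
    ∣K∣≤k  : length K ≤ k
    N⊆K    : N ⊆ˡ K
    N-ind  : Independent S N

Site-extend : ∀ {k S S′ t K N} → Valid k S → S ⊑ S′ → Site k S t K N → Site k S′ t K N
Site-extend {K = K} valid S⊑S′ site = record
  { t≤size = ℕ.≤-trans t≤size (_⊑_.size≤ S⊑S′)
  ; K⊆bag  = subst (K ⊆ˡ_) (sym (bag-≡ S⊑S′ t≤size)) K⊆bag
  ; ∣K∣≤k  = ∣K∣≤k
  ; N⊆K    = N⊆K
  ; N-ind  = Independent-extend S⊑S′ (∈-bag⇒<size valid t≤size ∘ K⊆bag ∘ N⊆K) N-ind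
  }
  where open Site site

push-valid : ∀ {k S t K N} → Valid k S → Site k S t K N → Valid k (push S t K N)
push-valid {k} {S} {t} {K} {N} valid site = record
  { parent≤     = parent≤′ ∘ split
  ; keep⊆       = λ l< → keep⊆′ (split l<)
  ; ∣keep∣≤k    = ∣keep∣≤k′ ∘ split
  ; back⊆       = λ l< → back⊆′ (split l<)
  ; independent = λ l< → independent′ (split l<)
  }
  where
  open Site site
  open Valid valid
  S′ = push S t K N
  n = size S

  split : ∀ {l} → l < suc n → l < n ⊎ l ≡ n
  split l< = ℕ.m≤n⇒m<n∨m≡n (s≤s⁻¹ l<)

  parent-new : parent S′ n ≡ t
  parent-new = ≔-same (parent S) n
  keep-new : keep S′ n ≡ K
  keep-new = ≔-same (keep S) n
  back-new : back S′ n ≡ N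
  back-new = ≔-same (back S) n
  S⊑S′ : S ⊑ S′
  S⊑S′ = ⊑-push S
  open _⊑_ S⊑S′

  parent≤′ : ∀ {l} → l < n ⊎ l ≡ n → parent S′ l ≤ l
  parent≤′ (inj₁ l<n)  = subst (_≤ _) (sym (parent≡ l<n)) (parent≤ l<n)
  parent≤′ (inj₂ refl) = subst (_≤ n) (sym parent-new) t≤size

  keep⊆′ : ∀ {l} → l < n ⊎ l ≡ n → keep S′ l ⊆ˡ bag S′ (parent S′ l)
  keep⊆′ (inj₁ l<n) rewrite parent≡ l<n | keep≡ l<n | bag-≡ S⊑S′ (ℕ.≤-trans (parent≤ l<n) (ℕ.<⇒≤ l<n)) = keep⊆ l<n
  keep⊆′ (inj₂ refl) rewrite parent-new | keep-new | bag-≡ S⊑S′ t≤size = K⊆bag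

  ∣keep∣≤k′ : ∀ {l} → l < n ⊎ l ≡ n → length (keep S′ l) ≤ k
  ∣keep∣≤k′ (inj₁ l<n)  = subst (λ L → length L ≤ k) (sym (keep≡ l<n)) (∣keep∣≤k l<n)
  ∣keep∣≤k′ (inj₂ refl) = subst (λ L → length L ≤ k) (sym keep-new) ∣K∣≤k

  back⊆′ : ∀ {l} → l < n ⊎ l ≡ n → back S′ l ⊆ˡ keep S′ l
  back⊆′ (inj₁ l<n)  = subst₂ _⊆ˡ_ (sym (back≡ l<n)) (sym (keep≡ l<n)) (back⊆ l<n)
  back⊆′ (inj₂ refl) = subst₂ _⊆ˡ_ (sym back-new) (sym keep-new) N⊆K

  independent′ : ∀ {l} → l < n ⊎ l ≡ n → Independent S′ (back S′ l)
  independent′ (inj₁ l<n)  = subst (Independent S′) (sym (back≡ l<n))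
    (Independent-extend S⊑S′ (λ u∈ → ℕ.<-trans (∈-back⇒< valid l<n u∈) l<n) (independent l<n))
  independent′ (inj₂ refl) = subst (Independent S′) (sym back-new)
    (Independent-extend S⊑S′ (∈-bag⇒<size valid t≤size ∘ K⊆bag ∘ N⊆K) N-ind)

-- Counting and rearranging lists

length-filter-∁ : ∀ {A : Set} {P : Pred A _} (P? : Decidable {ℓ = 0ℓ} P) xs →
  length xs ≡ length (filter P? xs) + length (filter (¬? ∘ P?) xs)
length-filter-∁ P? [] = refl
length-filter-∁ P? (x ∷ xs) with P? x
... | yes _ = cong suc (length-filter-∁ P? xs)
... | no _  = trans (cong suc (length-filter-∁ P? xs)) (sym (ℕ.+-suc _ _))

-- The entries with value `u` are split off and the others counted recursively. The bound `d` is
-- assumed for every `zs` inside `ys` so that it passes to the filtered list.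
pigeonhole-≤ : ∀ {A : Set} (c : A → ℕ) d N {ys} → Unique ys →
  (∀ {u zs} → u ∈ˡ N → Unique zs → zs ⊆ˡ ys → All (λ z → c z ≡ u) zs → length zs ≤ d) →
  All (λ y → c y ∈ˡ N) ys → length ys ≤ length N * d
pigeonhole-≤ c d []      {[]} un few in-N = z≤n
pigeonhole-≤ c d []      {_ ∷ _} un few (() ∷ _)
pigeonhole-≤ c d (u ∷ N) {ys} un few in-N = subst (_≤ d + length N * d) (sym (length-filter-∁ P? ys))
  (ℕ.+-mono-≤
    (few (here refl) (Unique.filter⁺ P? un) (proj₁ ∘ ∈-filter⁻ P?) (All.all-filter P? ys))
    (pigeonhole-≤ c d N (Unique.filter⁺ (¬? ∘ P?) un)
      (λ u∈ un′ zs⊆ → few (there u∈) un′ (proj₁ ∘ ∈-filter⁻ (¬? ∘ P?) ∘ zs⊆))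
      (All.zipWith (λ { (¬P , here eq) → contradiction eq ¬P ; (_ , there ∈N) → ∈N })
        (All.all-filter (¬? ∘ P?) ys , All.filter⁺ (¬? ∘ P?) in-N))))
  where P? = λ y → c y ℕ.≟ u

-- The pigeonhole bound for the map `id`, under which each value is taken at most once.
unique-⊆⇒length≤ : ∀ {xs L : List ℕ} → Unique xs → All (_∈ˡ L) xs → length xs ≤ length L
unique-⊆⇒length≤ {xs} {L} un xs⊆L = subst (length xs ≤_) (ℕ.*-identityʳ _)
  (pigeonhole-≤ id 1 L un (λ _ un′ _ → one un′) xs⊆L)
  where
  one : ∀ {u zs} → Unique zs → All (_≡ u) zs → length zs ≤ 1
  one {zs = []}        _                _                 = z≤n
  one {zs = _ ∷ []}    _                _                 = s≤s z≤n
  one {zs = _ ∷ _ ∷ _} ((≢ ∷ _) ∷ _) (refl ∷ refl ∷ _) = contradiction refl ≢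

unique-++-disjoint : ∀ xs {ys : List ℕ} {v} → Unique (xs ++ ys) → v ∈ˡ xs → v ∉ˡ ys
unique-++-disjoint (x ∷ xs) (x∉ ∷ un) (here refl) v∈ = All.lookup x∉ (∈-++⁺ʳ xs v∈) refl
unique-++-disjoint (x ∷ xs) (_ ∷ un)  (there v∈)  = unique-++-disjoint xs un v∈

unique-++ʳ : ∀ xs {ys : List ℕ} → Unique (xs ++ ys) → Unique ys
unique-++ʳ []       un       = un
unique-++ʳ (x ∷ xs) (_ ∷ un) = unique-++ʳ xs un

++-insert-↭ : ∀ {u : ℕ} xs A B → u ∷ xs ++ (A ++ B) ↭ xs ++ (A ++ u ∷ B)
++-insert-↭ {u} xs A B = begin
  u ∷ xs ++ (A ++ B)     ≡⟨ cong (u ∷_) (++-assoc xs A B) ⟨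
  u ∷ (xs ++ A) ++ B     ↭⟨ ↭.shift u (xs ++ A) B ⟨
  (xs ++ A) ++ u ∷ B     ≡⟨ ++-assoc xs A (u ∷ B) ⟩
  xs ++ (A ++ u ∷ B)     ∎
  where open PermutationReasoning

Unique-resp-↭ : ∀ {xs ys : List ℕ} → xs ↭ ys → Unique xs → Unique ys
Unique-resp-↭ p = ↭ₛ.Unique-resp-↭ (setoid ℕ) (↭⇒↭ₛ p)

unique-below : ∀ {n xs} → Unique xs → All (_< n) xs → length xs ≤ n
unique-below {n} {xs} un below = subst (length xs ≤_) (length-upTo n) (unique-⊆⇒length≤ un (All.map ∈-upTo⁺ below))

-- Forcing rainbow independent sets

module _ (k q d : ℕ) (2q≤k : q + q ≤ k) (q<k : suc q ≤ k) where

  -- A version of `q + 1` colours and defect `d` that mentions no components. The colouring is a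
  -- function on all of `ℕ`, so it can be read on every scheme below `S` without change.
  record LowDegree (S : Scheme) (c : ℕ → ℕ) : Set where
    field
      few-colours : ∀ {l} → l < size S → c l < suc q
      few-near    : ∀ {u ys} → u < size S → Unique ys →
        All (λ y → y < size S × Adj S u y × c y ≡ c u) ys → length ys ≤ d

  LowDegree-restrict : ∀ {S S′ c} → S ⊑ S′ → LowDegree S′ c → LowDegree S c
  LowDegree-restrict S⊑S′ low = record
    { few-colours = λ l< → few-colours (ℕ.<-≤-trans l< size≤)
    ; few-near    = λ u< un near → few-near (ℕ.<-≤-trans u< size≤) un
        (All.map (λ (y< , adj , same) → ℕ.<-≤-trans y< size≤ , Adj-extend S⊑S′ u< y< adj , same) near)
    }
    where open LowDegree low
          open _⊑_ S⊑S′

  -- The extension is fixed before the colouring is known and must refute every low-degree colouring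
  -- satisfying `Q`.
  Defeats : Scheme → ((ℕ → ℕ) → Set) → Set
  Defeats S Q = ∃[ S′ ] (S ⊑ S′ × Valid k S′ × (∀ c → LowDegree S′ c → ¬ Q c))

  Defeats-⇒ : ∀ {S} {Q Q′ : (ℕ → ℕ) → Set} → (∀ c → Q c → Q′ c) → Defeats S Q′ → Defeats S Q
  Defeats-⇒ Q⇒Q′ (S′ , e , valid , wins) = S′ , e , valid , λ c low → wins c low ∘ Q⇒Q′ c

  -- The extensions are made one after the other. The first keeps its effect because low-degree
  -- colourings restrict to smaller schemes.
  Defeats-∪ : ∀ {S} {Q Q′ : (ℕ → ℕ) → Set} → Defeats S Q →
    (∀ {S′} → S ⊑ S′ → Valid k S′ → Defeats S′ Q′) → Defeats S (λ c → Q c ⊎ Q′ c)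
  Defeats-∪ (S₁ , e₁ , valid₁ , wins₁) next with next e₁ valid₁
  ... | S₂ , e₂ , valid₂ , wins₂ = S₂ , ⊑-trans e₁ e₂ , valid₂ , λ c low →
    [ wins₁ c (LowDegree-restrict e₂ low) , wins₂ c low ]′

  Defeats-∃ : ∀ {S} {Q : ℕ → (ℕ → ℕ) → Set} → Valid k S → ∀ L →
    (∀ {u S′} → u ∈ˡ L → S ⊑ S′ → Valid k S′ → Defeats S′ (Q u)) →
    Defeats S (λ c → ∃[ u ] (u ∈ˡ L × Q u c))
  Defeats-∃ valid []      each = _ , ⊑-refl , valid , λ { _ _ (_ , () , _) }
  Defeats-∃ valid (u ∷ L) each = Defeats-⇒
    (λ { c (_ , here refl , Qc) → inj₁ Qc ; c (v , there v∈ , Qc) → inj₂ (v , v∈ , Qc) })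
    (Defeats-∪ (each (here refl) ⊑-refl valid)
      (λ e valid′ → Defeats-∃ valid′ L λ u∈ e′ → each (there u∈) (⊑-trans e e′)))

  module _ {S t K N} (Q : (ℕ → ℕ) → Set) (valid : Valid k S) (site : Site k S t K N) where
    open Site site

    -- The new vertex is `size S′`. All extensions `S′` are allowed because vertices are attached in
    -- succession, each on top of the responses to the previous ones.
    Attachable : Set
    Attachable = ∀ {S′} → S ⊑ S′ → Valid k S′ →
      Defeats (push S′ t K N) (λ c → Q c × c (size S′) ∉ˡ map c N)

    -- Each response is built right after its vertex, so in the final scheme a low-degree colouring
    -- with `Q` can give none of `ys` a colour missing from `N`.
    attach-many : Attachable → ∀ r → ∃₂ λ S′ ys → S ⊑ S′ × Valid k S′ × length ys ≡ r × Unique ys ×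
      All (λ y → y < size S′ × ∀ u → u ∈ˡ N → Adj S′ u y) ys ×
      (∀ c → LowDegree S′ c → All (λ y → ¬ (Q c × c y ∉ˡ map c N)) ys)
    attach-many attachable zero = S , [] , ⊑-refl , valid , refl , [] , [] , λ _ _ → []
    attach-many attachable (suc r) with attach-many attachable r
    ... | S₁ , ys , e₁ , valid₁ , refl , un , near , wins with attachable e₁ valid₁
    ... | S₂ , e₂ , valid₂ , wins₂ = S₂ , size S₁ ∷ ys , ⊑-trans e₁ e₁₂ , valid₂ , refl ,
      All.map (λ { (y< , _) refl → ℕ.<-irrefl refl y< }) near ∷ un ,
      (_⊑_.size≤ e₂ , λ u u∈ → Adj-extend e₂ (ℕ.m≤n⇒m≤1+n (N< u∈)) ℕ.≤-refl (Adj-push S₁ {t} {K} u∈)) ∷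
        All.map (λ (y< , adj) → ℕ.<-≤-trans y< (_⊑_.size≤ e₁₂) , λ u u∈ → Adj-extend e₁₂ (N< u∈) y< (adj u u∈)) near ,
      λ c low → wins₂ c low ∷ wins c (LowDegree-restrict e₁₂ low)
      where
      e₁₂ = ⊑-trans (⊑-push S₁) e₂

      N< : ∀ {u} → u ∈ˡ N → u < size S₁
      N< u∈ = ℕ.<-≤-trans (∈-bag⇒<size valid t≤size (K⊆bag (N⊆K u∈))) (_⊑_.size≤ e₁)

    -- Each vertex of N has at most d neighbours of its colour, so among d ∣N∣ + 1
    -- new vertices attached to N one has a colour not occurring on N.
    attach : Attachable → Defeats S Q
    attach attachable with attach-many attachable (suc (length N * d))
    ... | S′ , ys , e , valid′ , ∣ys∣ , un , near , wins = S′ , e , valid′ , λ c low Qc →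
      ℕ.<⇒≱ (ℕ.≤-reflexive (sym ∣ys∣)) (subst (λ m → length ys ≤ m * d) (length-map c N)
        (pigeonhole-≤ c d (map c N) un (few c low)
          (All.map (λ {y} ¬fresh → decidable-stable (c y ∈ˡ? map c N) λ fresh → ¬fresh (Qc , fresh)) (wins c low))))
      where
      few : ∀ c → LowDegree S′ c → ∀ {x zs} → x ∈ˡ map c N → Unique zs → zs ⊆ˡ ys →
        All (λ z → c z ≡ x) zs → length zs ≤ d
      few c low x∈ un zs⊆ same with u , u∈ , refl ← ∈-map⁻ c x∈ =
        LowDegree.few-near low (ℕ.<-≤-trans (∈-bag⇒<size valid t≤size (K⊆bag (N⊆K u∈))) (_⊑_.size≤ e)) un
          (All.tabulate λ z∈ → let z< , adj = All.lookup near (zs⊆ z∈) in z< , adj u u∈ , All.lookup same z∈)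

  olds news : List (ℕ × ℕ) → List ℕ
  olds = map proj₁
  news = map proj₂

  -- P holds pairs (u , x) of vertices that are to have the same colour; R holds
  -- the unpaired vertices.  Some new vertex attached to the u's has a colour not
  -- among theirs: either it can be paired with a vertex of R, or it enlarges the
  -- rainbow independent set made of the x's and R.
  record Config (S : Scheme) (t : ℕ) (P : List (ℕ × ℕ)) (R : List ℕ) : Set where
    field
      t≤size   : t ≤ size S
      in-bag   : (olds P ++ R) ++ news P ⊆ˡ bag S t
      distinct : Unique ((olds P ++ R) ++ news P)
      olds-ind : Independent S (olds P ++ R)
      news-ind : Independent S (news P ++ R)

  Rainbow : List (ℕ × ℕ) → List ℕ → (ℕ → ℕ) → Set
  Rainbow P R c = Unique (map c (olds P ++ R)) × All (λ (u , x) → c u ≡ c x) P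

  news++R⊆ : ∀ P {R} → news P ++ R ⊆ˡ (olds P ++ R) ++ news P
  news++R⊆ P {R} v∈ = [ ∈-++⁺ʳ (olds P ++ R) , ∈-++⁺ˡ ∘ ∈-++⁺ʳ (olds P) ]′ (∈-++⁻ (news P) v∈)

  Config-extend : ∀ {S S′ t P R} → Valid k S → S ⊑ S′ → Config S t P R → Config S′ t P R
  Config-extend {P = P} {R} valid e config = record
    { t≤size   = ℕ.≤-trans t≤size (_⊑_.size≤ e)
    ; in-bag   = subst (_ ⊆ˡ_) (sym (bag-≡ e t≤size)) in-bag
    ; distinct = distinct
    ; olds-ind = Independent-extend e (∈-bag⇒<size valid t≤size ∘ in-bag ∘ ∈-++⁺ˡ) olds-ind
    ; news-ind = Independent-extend e (∈-bag⇒<size valid t≤size ∘ in-bag ∘ news++R⊆ P) news-ind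
    }
    where open Config config

  module _ {S t P R} (valid : Valid k S) (config : Config S t P R) where
    open Config config

    kept : List ℕ
    kept = (olds P ++ R) ++ news P

    newest : ℕ
    newest = size S

    grown : Scheme
    grown = push S t kept (olds P)

    kept< : ∀ {v} → v ∈ˡ kept → v < size S
    kept< = ∈-bag⇒<size valid t≤size ∘ in-bag

    newest∉kept : All (newest ≢_) kept
    newest∉kept = All.tabulate λ v∈ newest≡v → ℕ.<-irrefl (sym newest≡v) (kept< v∈)

    olds++R++news : Unique (olds P ++ R ++ news P)
    olds++R++news = subst Unique (++-assoc (olds P) R (news P)) distinct

    grown-bag : newest ∷ kept ⊆ˡ bag grown (suc newest)
    grown-bag {v} = subst (v ∈ˡ_) (sym (bag-push S {t} {kept} {olds P}))

    -- The new vertex is adjacent only to the `olds`, which `distinct` separates from the `news` and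
    -- `R`.
    newest-nonadj : ∀ {v} → v ∈ˡ news P ++ R → ¬ Adj grown v newest
    newest-nonadj v∈ adj = unique-++-disjoint (olds P) olds++R++news
      (Adj-push⁻ {t = t} {K = kept} valid (kept< (news++R⊆ P v∈)) adj)
      (↭.∈-resp-↭ (↭.++-comm (news P) R) v∈)

    youngest-ind : Valid k grown → Independent grown (newest ∷ news P ++ R)
    youngest-ind valid₁ (here refl) (here refl) = Adj-irrefl valid₁ ℕ.≤-refl
    youngest-ind valid₁ (here refl) (there v∈)  = newest-nonadj v∈ ∘ [ inj₂ , inj₁ ]′
    youngest-ind valid₁ (there u∈)  (here refl) = newest-nonadj u∈
    youngest-ind valid₁ (there u∈)  (there v∈)  =
      Independent-extend (⊑-push S {t} {kept} {olds P}) (kept< ∘ news++R⊆ P) news-ind u∈ v∈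

    -- For a new vertex of a new colour: the `olds` are discarded and pairing restarts from an
    -- unpaired set.
    fresh-config : Valid k grown → Config grown (suc newest) [] (newest ∷ news P ++ R)
    fresh-config valid₁ = record
      { t≤size   = ℕ.≤-refl
      ; in-bag   = grown-bag ∘ ∷⁺ʳ newest (news++R⊆ P) ∘ ↭.∈-resp-↭ (↭.++-identityʳ _)
      ; distinct = Unique-resp-↭ (↭-sym (↭.++-identityʳ _))
          (All.anti-mono (news++R⊆ P) newest∉kept ∷
           Unique-resp-↭ (↭.++-comm R (news P)) (unique-++ʳ (olds P) olds++R++news))
      ; olds-ind = youngest-ind valid₁
      ; news-ind = youngest-ind valid₁
      }

    paired-↭ : ∀ {u} A B → R ≡ A ++ u ∷ B → (olds ((u , newest) ∷ P) ++ (A ++ B)) ++ news ((u , newest) ∷ P) ↭ newest ∷ kept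
    paired-↭ {u} A B refl = begin
      (u ∷ olds P ++ (A ++ B)) ++ newest ∷ news P    ↭⟨ ↭.shift newest (u ∷ olds P ++ (A ++ B)) (news P) ⟩
      newest ∷ (u ∷ olds P ++ (A ++ B)) ++ news P    ↭⟨ prep newest (↭.++⁺ʳ (news P) (++-insert-↭ (olds P) A B)) ⟩
      newest ∷ kept                                  ∎
      where open PermutationReasoning

    -- For a new vertex coloured like `u`: it becomes the partner of `u`, which passes from `R` to
    -- the `olds`.
    paired-config : ∀ {u} A B → R ≡ A ++ u ∷ B → Valid k grown → Config grown (suc newest) ((u , newest) ∷ P) (A ++ B)
    paired-config {u} A B refl valid₁ = record
      { t≤size   = ℕ.≤-refl
      ; in-bag   = grown-bag ∘ ↭.∈-resp-↭ (paired-↭ A B refl)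
      ; distinct = Unique-resp-↭ (↭-sym (paired-↭ A B refl)) (newest∉kept ∷ distinct)
      ; olds-ind = λ v∈ w∈ →
          Independent-extend (⊑-push S {t} {kept} {olds P}) (kept< ∘ ∈-++⁺ˡ) olds-ind (shrink v∈) (shrink w∈)
      ; news-ind = λ v∈ w∈ → youngest-ind valid₁ (widen v∈) (widen w∈)
      }
      where
      shrink : u ∷ olds P ++ (A ++ B) ⊆ˡ olds P ++ (A ++ u ∷ B)
      shrink = ↭.∈-resp-↭ (++-insert-↭ (olds P) A B)

      widen : newest ∷ news P ++ (A ++ B) ⊆ˡ newest ∷ news P ++ (A ++ u ∷ B)
      widen = ∷⁺ʳ newest (↭.∈-resp-↭ (++-insert-↭ (news P) A B) ∘ there)

  -- The `news` repeat the colours of the `olds`, so replacing the latter loses no colour and `y`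
  -- adds one.
  fresh-rainbow : ∀ {P R c y} → Rainbow P R c → c y ∉ˡ map c (olds P) → c y ∉ˡ map c R → Rainbow [] (y ∷ news P ++ R) c
  fresh-rainbow {P} {R} {c} {y} (unique , same) y∉olds y∉R =
    subst (λ L → Unique (c y ∷ L)) (sym same-colours)
      (All.¬Any⇒All¬ _ y∉ ∷ unique) , []
    where
    y∉ : c y ∉ˡ map c (olds P ++ R)
    y∉ y∈ = [ y∉olds , y∉R ]′ (∈-++⁻ (map c (olds P)) (subst (c y ∈ˡ_) (map-++ c (olds P) R) y∈))

    pairs : ∀ {P} → All (λ (u , x) → c u ≡ c x) P → map c (news P) ≡ map c (olds P)
    pairs []           = refl
    pairs (eq ∷ same) = cong₂ _∷_ (sym eq) (pairs same)

    same-colours : map c (news P ++ R) ≡ map c (olds P ++ R)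
    same-colours = trans (map-++ c (news P) R) (trans (cong (_++ map c R) (pairs same)) (sym (map-++ c (olds P) R)))

  paired-rainbow : ∀ {P R c u y} A B → R ≡ A ++ u ∷ B → Rainbow P R c → c y ≡ c u → Rainbow ((u , y) ∷ P) (A ++ B) c
  paired-rainbow {P} {c = c} A B refl (unique , same) cy≡cu =
    Unique-resp-↭ (↭.map⁺ c (↭-sym (++-insert-↭ (olds P) A B))) unique , sym cy≡cu ∷ same

  -- A vertex whose colour is missing from `q + 1` differently coloured ones would need a further
  -- colour below `suc q`. Hence attaching vertices to all of `olds P ++ R` requires no further
  -- response.
  final-win : ∀ {S t P R} → Valid k S → Config S t P R → length (olds P ++ R) ≡ suc q → Defeats S (Rainbow P R)
  final-win {S} {t} {P} {R} valid config ∣O∣ = attach (Rainbow P R) valid site λ {S′} e valid′ →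
    push S′ t O O , ⊑-refl , push-valid valid′ (Site-extend valid e site) , λ c low ((unique , _) , fresh) →
      let open LowDegree low
          O-colours = All.map⁺ (All.tabulate λ u∈ → few-colours (ℕ.m≤n⇒m≤1+n
            (ℕ.<-≤-trans (∈-bag⇒<size valid t≤size (in-bag (∈-++⁺ˡ u∈))) (_⊑_.size≤ e))))
      in ℕ.<⇒≱ ℕ.≤-refl (subst (λ n → suc n ≤ suc q) (trans (length-map c O) ∣O∣)
           (unique-below (All.¬Any⇒All¬ _ fresh ∷ unique) (few-colours ℕ.≤-refl ∷ O-colours)))
    where
    open Config config
    O = olds P ++ R

    site : Site k S t O O
    site = record
      { t≤size = t≤size
      ; K⊆bag  = in-bag ∘ ∈-++⁺ˡ
      ; ∣K∣≤k  = subst (_≤ k) (sym ∣O∣) q<k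
      ; N⊆K    = id
      ; N-ind  = olds-ind
      }

  -- `r` is the number of colours by which the rainbow set falls short of `q + 1`.
  WinsFrom : ℕ → Set
  WinsFrom r = ∀ {S t P R} → Valid k S → Config S t P R → length (olds P ++ R) + r ≡ suc q → Defeats S (Rainbow P R)

  -- A new colour lowers the deficit and is left to `above`; a repeated one pairs off a vertex of
  -- `R`. The latter happens at most `length R` times, which `s` bounds.
  climb : ∀ r → WinsFrom r → ∀ s {S t P R} → Valid k S → Config S t P R → length R ≤ s →
    length (olds P ++ R) + suc r ≡ suc q → Defeats S (Rainbow P R)
  climb r above s {S} {t} {P} {R} valid config ∣R∣≤s ∣O∣ =
    attach (Rainbow P R) valid site respond
    where
    open Config config
    ∣news∣ : length (news P) ≡ length (olds P)
    ∣news∣ = trans (length-map proj₂ P) (sym (length-map proj₁ P))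

    ∣news++R∣ : length (news P ++ R) ≡ length (olds P ++ R)
    ∣news++R∣ = trans (length-++ (news P)) (trans (cong (_+ length R) ∣news∣) (sym (length-++ (olds P))))

    ∣O∣≤q : length (olds P ++ R) ≤ q
    ∣O∣≤q = s≤s⁻¹ (subst (suc (length (olds P ++ R)) ≤_) (trans (sym (ℕ.+-suc _ r)) ∣O∣) (s≤s (ℕ.m≤m+n _ r)))

    ∣news∣≤q : length (news P) ≤ q
    ∣news∣≤q = begin
      length (news P)               ≡⟨ ∣news∣ ⟩
      length (olds P)               ≤⟨ ℕ.m≤m+n _ (length R) ⟩
      length (olds P) + length R    ≡⟨ length-++ (olds P) ⟨
      length (olds P ++ R)          ≤⟨ ∣O∣≤q ⟩
      q                             ∎
      where open ℕ.≤-Reasoning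

    -- The rainbow set has at most `q` vertices and so do the `news`; this is where `2q ≤ k` enters.
    ∣K∣≤k : length ((olds P ++ R) ++ news P) ≤ k
    ∣K∣≤k = ℕ.≤-trans (ℕ.≤-reflexive (length-++ (olds P ++ R))) (ℕ.≤-trans (ℕ.+-mono-≤ ∣O∣≤q ∣news∣≤q) 2q≤k)

    site : Site k S t ((olds P ++ R) ++ news P) (olds P)
    site = record
      { t≤size = t≤size
      ; K⊆bag  = in-bag
      ; ∣K∣≤k  = ∣K∣≤k
      ; N⊆K    = ∈-++⁺ˡ ∘ ∈-++⁺ˡ
      ; N-ind  = λ u∈ v∈ → olds-ind (∈-++⁺ˡ u∈) (∈-++⁺ˡ v∈)
      }

    respond : Attachable (Rainbow P R) valid site
    -- The colour of `y` is not known yet, so one extension serves all outcomes: first a new colour,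
    -- then each possible partner in `R` in turn.
    respond {S′} e valid′ = Defeats-⇒ outcome
      (Defeats-∪ fresh (λ e₁ valid₁′ → Defeats-∃ valid₁′ R λ {u} u∈R e₂ valid₂ → paired u∈R (⊑-trans e₁ e₂) valid₂ s ∣R∣≤s))
      where
      config′ : Config S′ t P R
      config′ = Config-extend valid e config
      y = size S′
      S₁ = push S′ t (kept valid′ config′) (olds P)
      valid₁ : Valid k S₁
      valid₁ = push-valid valid′ (Site-extend valid e site)

      Pairs : ℕ → (ℕ → ℕ) → Set
      Pairs u c = Rainbow P R c × c y ≡ c u

      fresh : Defeats S₁ (Rainbow [] (y ∷ news P ++ R))
      fresh = above valid₁ (fresh-config valid′ config′ valid₁)
        (trans (cong (λ n → suc n + r) ∣news++R∣) (trans (sym (ℕ.+-suc _ r)) ∣O∣))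

      paired : ∀ {u S₂} → u ∈ˡ R → S₁ ⊑ S₂ → Valid k S₂ → ∀ s → length R ≤ s → Defeats S₂ (Pairs u)
      paired {u} u∈R e valid₂ s ∣R∣≤s with A , B , R≡ ← ∈-∃++ u∈R = go s ∣R∣≤s
        where
        ∣R∣ : length R ≡ suc (length (A ++ B))
        ∣R∣ = trans (cong length R≡) (↭.↭-length (↭.shift u A B))
        go : ∀ s → length R ≤ s → Defeats _ (Pairs u)
        go zero    ∣R∣≤0 = contradiction (subst (_≤ 0) ∣R∣ ∣R∣≤0) λ ()
        go (suc s) ∣R∣≤  = Defeats-⇒ (λ c (rainbow , same) → paired-rainbow A B R≡ rainbow same)
          (climb r above s valid₂ (Config-extend valid₁ e (paired-config valid′ config′ A B R≡ valid₁))
            (s≤s⁻¹ (subst (_≤ suc s) ∣R∣ ∣R∣≤)) (trans (cong (_+ suc r) ∣paired∣) ∣O∣))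
          where
          ∣paired∣ : suc (length (olds P ++ A ++ B)) ≡ length (olds P ++ R)
          ∣paired∣ = trans (↭.↭-length (++-insert-↭ (olds P) A B)) (cong (λ L → length (olds P ++ L)) (sym R≡))

      outcome : ∀ c → Rainbow P R c × c y ∉ˡ map c (olds P) →
        Rainbow [] (y ∷ news P ++ R) c ⊎ ∃[ u ] (u ∈ˡ R × Pairs u c)
      outcome c (rainbow , y∉olds) with c y ∈ˡ? map c R
      ... | no y∉R  = inj₁ (fresh-rainbow rainbow y∉olds y∉R)
      ... | yes y∈R = let u , u∈R , eq = ∈-map⁻ c y∈R in inj₂ (u , u∈R , rainbow , eq)

  win : ∀ r → WinsFrom r
  win zero    valid config ∣O∣ = final-win valid config (trans (sym (ℕ.+-identityʳ _)) ∣O∣)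
  win (suc r) valid config ∣O∣ = climb r (win r) _ valid config ℕ.≤-refl ∣O∣

-- Rooted trees, and the graph and tree decomposition of a scheme

enumeration : ∀ {n} (S : Subset n) → ∃[ xs ] (Unique xs × All (_∈ S) xs × length xs ≡ ∣ S ∣)
enumeration [] = [] , [] , [] , refl
enumeration (false ∷ S) with xs , un , ∈S , eq ← enumeration S =
  map suc xs , Unique.map⁺ (λ { refl → refl }) un , All.map⁺ (All.map there ∈S) , trans (length-map suc xs) eq
enumeration (true ∷ S) with xs , un , ∈S , eq ← enumeration S =
  zero ∷ map suc xs ,
  All.map⁺ (All.tabulate λ _ ()) ∷ Unique.map⁺ (λ { refl → refl }) un ,
  here ∷ All.map⁺ (All.map there ∈S) ,
  cong suc (trans (length-map suc xs) eq)

module _ (T : Graph) (Up : Graph.Vertex T → Graph.Vertex T → Set)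
         (up-down : ∀ {x y} → Graph._~_ T x y → Up x y ⊎ Up y x)
         (up⇒< : ∀ {x y} → Up x y → toℕ y < toℕ x)
         (up-unique : ∀ {x y z} → Up x y → Up x z → y ≡ z) where
  open Graph T

  -- After a step down from p to x the path cannot go up again: that would be back to p.
  descend : ∀ {p x w} vs → Up x p → All (p ≢_) vs → p ≢ w → Unique (x ∷ vs) → All (_≢ w) (x ∷ vs) →
    Linked _~_ (x ∷ vs ++ [ w ]) → ∃[ l ] (l ∈ˡ x ∷ vs × Up w l × toℕ x < toℕ w)
  descend [] down _ p≢w _ _ (x~w ∷ [-]) with up-down x~w
  ... | inj₁ up   = contradiction (up-unique down up) p≢w
  ... | inj₂ down′ = _ , here refl , down′ , up⇒< down′
  descend (z ∷ vs) down (p≢z ∷ _) p≢w ((_ ∷ x∉) ∷ un) (x≢w ∷ ≢w) (x~z ∷ linked) with up-down x~z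
  ... | inj₁ up    = contradiction (up-unique down up) p≢z
  ... | inj₂ down′ with l , l∈ , up , z<w ← descend vs down′ x∉ x≢w un ≢w linked =
    l , there l∈ , up , ℕ.<-trans (up⇒< down′) z<w

  -- The path climbs through numbers below that of `w`, so it can return to `w` only from its parent
  -- `a`, which it avoids.
  ascend : ∀ {a x w} vs → Up w a → All (a ≢_) (x ∷ vs) → toℕ x < toℕ w → Unique (x ∷ vs) → All (_≢ w) (x ∷ vs) →
    ¬ Linked _~_ (x ∷ vs ++ [ w ])
  ascend [] wa (a≢x ∷ _) x<w _ _ (x~w ∷ [-]) with up-down x~w
  ... | inj₁ up   = ℕ.<-asym x<w (up⇒< up)
  ... | inj₂ down = a≢x (up-unique wa down)
  ascend (z ∷ vs) wa (a≢x ∷ a∉) x<w ((_ ∷ x∉) ∷ un) (x≢w ∷ ≢w) (x~z ∷ linked) with up-down x~z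
  ... | inj₁ up   = ascend vs wa a∉ (ℕ.<-trans (up⇒< up) x<w) un ≢w linked
  ... | inj₂ down with l , l∈ , wl , _ ← descend vs down x∉ x≢w un ≢w linked =
    All.lookup a∉ l∈ (up-unique wa wl)

  -- From its start v a cycle would climb to the parent of v, and later come back
  -- to v from that same parent.
  parents⇒acyclic : ∀ vs → ¬ IsCycle T vs
  parents⇒acyclic (v ∷ [])     (() , _)
  parents⇒acyclic (v ∷ _ ∷ []) (s≤s () , _)
  parents⇒acyclic (v ∷ x ∷ z ∷ vs) (_ , ((v≢x ∷ v≢z ∷ v∉) ∷ (x≢z ∷ x∉) ∷ un) , v~x ∷ x~z ∷ linked)
    with up-down v~x | up-down x~z
  ... | inj₁ vx | inj₁ xz = ascend vs vx (x≢z ∷ x∉) (ℕ.<-trans (up⇒< xz) (up⇒< vx)) un (All.map (_∘ sym) (v≢z ∷ v∉)) linked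
  ... | inj₁ vx | inj₂ zx with l , l∈ , vl , _ ← descend vs zx x∉ (v≢x ∘ sym) un (All.map (_∘ sym) (v≢z ∷ v∉)) linked =
    All.lookup (x≢z ∷ x∉) l∈ (up-unique vx vl)
  ... | inj₂ xv | inj₁ xz = v≢z (up-unique xv xz)
  ... | inj₂ xv | inj₂ zx with _ , _ , _ , z<v ← descend vs zx x∉ (v≢x ∘ sym) un (All.map (_∘ sym) (v≢z ∷ v∉)) linked =
    ℕ.<-asym z<v (ℕ.<-trans (up⇒< xv) (up⇒< zx))

  module _ (up-adjacent : ∀ {x y} → Up x y → x ~ y) {P : Pred Vertex 0ℓ} {top : Vertex} (top∈ : P top)
           (next : ∀ {x} → P x → x ≢ top → ∃[ y ] (Up x y × P y)) where

    walk-to-top : ∀ b {x} → toℕ x ≤ b → P x → Star (Induced T P) x top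
    walk-to-top b {x} x≤b Px with x ≟ top
    ... | yes refl = ε
    ... | no x≢top with next Px x≢top
    ... | y , up , Py with b
    ... | zero   = contradiction (ℕ.<-≤-trans (up⇒< up) x≤b) λ ()
    ... | suc b′ = (Px , Py , up-adjacent up) ◅ walk-to-top b′ (s≤s⁻¹ (ℕ.<-≤-trans (up⇒< up) x≤b)) Py

    topped⇒connected : Connected T P
    topped⇒connected = (top , top∈) , λ Px Py →
      walk-to-top _ ℕ.≤-refl Px ◅◅
      reverse (λ (Pu , Pv , u~v) → Pv , Pu , ~-sym u~v) (walk-to-top _ ℕ.≤-refl Py)

module _ {k S} (valid : Valid k S) where
  open Valid valid

  Adj? : ∀ u v → Dec (Adj S u v)
  Adj? u v = (u ∈ˡ? back S v) ⊎-dec (v ∈ˡ? back S u)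

  graph : Graph
  graph = record
    { order = size S
    ; _~_   = λ u v → Adj S (toℕ u) (toℕ v)
    ; _~?_  = λ u v → Adj? (toℕ u) (toℕ v)
    ; ~-sym = swap
    ; ~-irr = λ { {u} refl → Adj-irrefl valid (toℕ<n u) }
    }

  private
    below : ∀ {u} {v : Graph.Vertex graph} → u ∈ˡ back S (toℕ v) → u < toℕ v
    below {v = v} = ∈-back⇒< valid (toℕ<n v)

    clash : ∀ (w : Graph.Vertex graph) {u v} → u ∈ˡ back S (toℕ w) → v ∈ˡ back S (toℕ w) → ¬ Adj S u v
    clash w = independent (toℕ<n w)

  -- The latest vertex of a triangle would have the other two in its independent list `back`. The
  -- two cyclic orientations contradict the order of the vertices.
  graph-triangleFree : TriangleFree graph
  graph-triangleFree {u} {v} {w} (inj₁ uv) (inj₁ vw) (inj₁ uw) = clash w uw vw (inj₁ uv)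
  graph-triangleFree {u} {v} {w} (inj₁ uv) (inj₁ vw) (inj₂ wu) =
    ℕ.<-asym (ℕ.<-trans (below {v = v} uv) (below {v = w} vw)) (below {v = u} wu)
  graph-triangleFree {u} {v} {w} (inj₁ uv) (inj₂ wv) u~w       = clash v uv wv u~w
  graph-triangleFree {u} {v} {w} (inj₂ vu) (inj₁ vw) (inj₁ uw) = clash w uw vw (inj₂ vu)
  graph-triangleFree {u} {v} {w} (inj₂ vu) (inj₁ vw) (inj₂ wu) = clash u vu wu (inj₁ vw)
  graph-triangleFree {u} {v} {w} (inj₂ vu) (inj₂ wv) (inj₁ uw) =
    ℕ.<-asym (ℕ.<-trans (below {v = v} wv) (below {v = u} vu)) (below {v = w} uw)
  graph-triangleFree {u} {v} {w} (inj₂ vu) (inj₂ wv) (inj₂ wu) = clash u vu wu (inj₂ wv)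

  Parent : Fin (suc (size S)) → Fin (suc (size S)) → Set
  Parent zero    y = ⊥
  Parent (suc l) y = parent S (toℕ l) ≡ toℕ y

  Parent? : ∀ x y → Dec (Parent x y)
  Parent? zero    y = no λ ()
  Parent? (suc l) y = parent S (toℕ l) ℕ.≟ toℕ y

  Parent⇒< : ∀ {x y} → Parent x y → toℕ y < toℕ x
  Parent⇒< {suc l} eq = s≤s (subst (_≤ toℕ l) eq (parent≤ (toℕ<n l)))

  Parent-unique : ∀ {x y z} → Parent x y → Parent x z → y ≡ z
  Parent-unique {suc l} xy xz = toℕ-injective (trans (sym xy) xz)

  parent-of : ∀ l → ∃ (Parent (suc l))
  parent-of l = fromℕ< l< , sym (toℕ-fromℕ< l<)
    where l< = s≤s (ℕ.≤-trans (parent≤ (toℕ<n l)) (ℕ.<⇒≤ (toℕ<n l)))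

  treeGraph : Graph
  treeGraph = record
    { order = suc (size S)
    ; _~_   = λ x y → Parent x y ⊎ Parent y x
    ; _~?_  = λ x y → Parent? x y ⊎-dec Parent? y x
    ; ~-sym = swap
    ; ~-irr = λ { {x} refl → [ (λ p → ℕ.<-irrefl refl (Parent⇒< {x} p)) , (λ p → ℕ.<-irrefl refl (Parent⇒< {x} p)) ]′ }
    }

  InBag : Fin (suc (size S)) → Fin (size S) → Set
  InBag t u = toℕ u ∈ˡ bag S (toℕ t)

  InBag? : ∀ t u → Dec (InBag t u)
  InBag? t u = toℕ u ∈ˡ? bag S (toℕ t)

  -- A vertex `u` first appears at node `suc u`; every other bag inherits it from its parent. Hence
  -- the nodes whose bags contain `u` form a subtree topped by `suc u`.
  up-from : ∀ {t u} → InBag t u → t ≢ suc u → ∃[ s ] (Parent t s × InBag s u)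
  up-from {suc l} (here u≡l) t≢ = contradiction (cong suc (sym (toℕ-injective u≡l))) t≢
  up-from {suc l} {u} (there u∈) _ with s , up ← parent-of l =
    s , up , subst (λ t → toℕ u ∈ˡ bag S t) up (keep⊆ (toℕ<n l) u∈)

  ∣bag∣≤ : ∀ t → ∣ subset (InBag? t) ∣ ≤ suc k
  ∣bag∣≤ t with xs , un , ∈S , ∣xs∣ ← enumeration (subset (InBag? t)) = begin
    ∣ subset (InBag? t) ∣   ≡⟨ ∣xs∣ ⟨
    length xs                      ≡⟨ length-map toℕ xs ⟨
    length (map toℕ xs)            ≤⟨ unique-⊆⇒length≤ (Unique.map⁺ toℕ-injective un)
                                         (All.map⁺ (All.map (∈-subset⁻ (InBag? t)) ∈S)) ⟩
    length (bag S (toℕ t))         ≤⟨ ∣bag∣≤′ t ⟩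
    suc k                          ∎
    where
    open ℕ.≤-Reasoning
    ∣bag∣≤′ : ∀ t → length (bag S (toℕ t)) ≤ suc k
    ∣bag∣≤′ zero    = z≤n
    ∣bag∣≤′ (suc l) = s≤s (∣keep∣≤k (toℕ<n l))

  edge-in-bag : ∀ {u v : Fin (size S)} → toℕ u ∈ˡ back S (toℕ v) →
    u ∈ subset (InBag? (suc v)) × v ∈ subset (InBag? (suc v))
  edge-in-bag {v = v} u∈ =
    ∈-subset⁺ (InBag? (suc v)) (there (back⊆ (toℕ<n v) u∈)) , ∈-subset⁺ (InBag? (suc v)) (here refl)

  decomposition : TreeDecomposition graph
  decomposition = record
    { tree      = treeGraph
    ; isTree    =
        topped⇒connected treeGraph Parent id Parent⇒< Parent-unique inj₁ {top = zero} tt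
          (λ { {zero} _ x≢ → contradiction refl x≢ ; {suc l} _ _ → let s , up = parent-of l in s , up , tt }) ,
        parents⇒acyclic treeGraph Parent id Parent⇒< Parent-unique
    ; bag       = λ t → subset (InBag? t)
    ; edge-bag  = λ { {u} {v} (inj₁ u∈) → suc v , edge-in-bag u∈
                    ; {u} {v} (inj₂ v∈) → let v∈t , u∈t = edge-in-bag v∈ in suc u , u∈t , v∈t }
    ; connected = λ u → topped⇒connected treeGraph Parent id Parent⇒< Parent-unique inj₁ {top = suc u}
        (∈-subset⁺ (InBag? (suc u)) (here refl))
        λ {t} u∈t t≢ → let s , up , u∈s = up-from (∈-subset⁻ (InBag? t) u∈t) t≢ in s , up , ∈-subset⁺ (InBag? s) u∈s
    }

  graph-treewidth : TreewidthAtMost k graph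
  graph-treewidth = decomposition , ℕ.∸-monoˡ-≤ {n = suc k} 1
    (max≤v⁺ {xs = map ∣bag∣ nodes} z≤n (All.map⁺ {f = ∣bag∣} (All.universal ∣bag∣≤ nodes)))
    where
    nodes = allFin (suc (size S))
    ∣bag∣ = λ t → ∣ subset (InBag? t) ∣

-- From colourings of the graph to colourings of the scheme

lift-< : ∀ {l n} → l < n → ∃ λ (i : Fin n) → toℕ i ≡ l
lift-< l<n = fromℕ< l<n , toℕ-fromℕ< l<n

lift-below : ∀ {n ys} → All (_< n) ys → ∃ λ (ys′ : List (Fin n)) → map toℕ ys′ ≡ ys
lift-below []         = [] , refl
lift-below (y< ∷ ys<) with ys′ , refl ← lift-below ys< = fromℕ< y< ∷ ys′ , cong (_∷ _) (toℕ-fromℕ< y<)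

module _ {k S} (valid : Valid k S) {j : ℕ} (c : Colouring (graph valid) j) where
  open Graph (graph valid)

  -- Schemes are coloured by functions on all of `ℕ`; beyond the graph `0` is an arbitrary default.
  number : ℕ → ℕ
  number l with l <? size S
  ... | yes l< = toℕ (c (fromℕ< l<))
  ... | no _   = 0

  number-toℕ : ∀ v → number (toℕ v) ≡ toℕ (c v)
  number-toℕ v with toℕ v <? size S
  ... | yes v< = cong (toℕ ∘ c) (fromℕ<-toℕ v v<)
  ... | no v≮  = contradiction (toℕ<n v) v≮

  defect⇒lowDegree : ∀ {q d} (2q≤k : q + q ≤ k) (q<k : suc q ≤ k) → j ≤ suc q → HasDefect (graph valid) c d →
    LowDegree k q d 2q≤k q<k S number
  defect⇒lowDegree {q} {d} 2q≤k q<k j≤ defect = record { few-colours = few-colours ; few-near = few-near }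
    where
    few-colours : ∀ {l} → l < size S → number l < suc q
    few-colours l< with v , refl ← lift-< l< =
      subst (_< suc q) (sym (number-toℕ v)) (ℕ.<-≤-trans (toℕ<n (c v)) j≤)

    few-near : ∀ {u ys} → u < size S → Unique ys →
      All (λ y → y < size S × Adj S u y × number y ≡ number u) ys → length ys ≤ d
    few-near u< un near
      with v , refl ← lift-< u< | zs , refl ← lift-below (All.map proj₁ near) =
      subst (_≤ d) (sym (length-map toℕ zs)) $
        defect⇒few-neighbours (graph valid) defect v (Unique.map⁻ un) $
        All.map (λ {z} (_ , adj , same) → adj , toℕ-injective (trans (sym (number-toℕ z)) (trans same (number-toℕ v))))
          (All.map⁻ near)

-- The game starts from the empty configuration with all `q + 1` colours missing. There
-- `Rainbow [] []` holds trivially, so every low-degree colouring is refuted.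
hard-graph : ∀ {k} q d → q + q ≤ k → suc q ≤ k →
  ∃[ G ] (TriangleFreeTreewidthAtMost k G × (∀ {j} (c : Colouring G j) → j ≤ suc q → ¬ HasDefect G c d))
hard-graph {k} q d 2q≤k q<k = graph valid , (graph-triangleFree valid , graph-treewidth valid) ,
  λ c j≤ defect → beats (number valid c) (defect⇒lowDegree valid c 2q≤k q<k j≤ defect) ([] , [])
  where
  empty : Scheme
  empty = record { size = 0 ; parent = const 0 ; keep = const [] ; back = const [] }

  empty-valid : Valid k empty
  empty-valid = record { parent≤ = λ () ; keep⊆ = λ () ; ∣keep∣≤k = λ () ; back⊆ = λ () ; independent = λ () }

  start : Config k q d 2q≤k q<k empty 0 [] []
  start = record { t≤size = z≤n ; in-bag = λ () ; distinct = [] ; olds-ind = λ () ; news-ind = λ () }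

  won = win k q d 2q≤k q<k (suc q) empty-valid start refl
  valid = proj₁ (proj₂ (proj₂ won))
  beats = proj₂ (proj₂ (proj₂ won))

-- The three chromatic numbers

⌊k/2⌋+⌊k/2⌋≤k : ∀ k → ⌊ k /2⌋ + ⌊ k /2⌋ ≤ k
⌊k/2⌋+⌊k/2⌋≤k k = ℕ.≤-trans (ℕ.+-monoʳ-≤ ⌊ k /2⌋ (ℕ.⌊n/2⌋≤⌈n/2⌉ k)) (ℕ.≤-reflexive (ℕ.⌊n/2⌋+⌈n/2⌉≡n k))

k<2⌈k+1/2⌉ : ∀ k → suc k ≤ ⌈ suc k /2⌉ * 2
k<2⌈k+1/2⌉ zero          = s≤s z≤n
k<2⌈k+1/2⌉ (suc zero)    = s≤s (s≤s z≤n)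
k<2⌈k+1/2⌉ (suc (suc k)) = s≤s (s≤s (k<2⌈k+1/2⌉ k))

corollary14 : (k : ℕ) → 1 ≤ k →
    IsDefectiveChromaticNumber (TriangleFreeTreewidthAtMost k) ⌈ k + 3 /2⌉ ×
    IsClusteredChromaticNumber (TriangleFreeTreewidthAtMost k) ⌈ k + 3 /2⌉ ×
    IsClassChromaticNumber (TriangleFreeTreewidthAtMost k) ⌈ k + 3 /2⌉
corollary14 k@(suc k′) _ rewrite ℕ.+-comm k′ 3 =
  ( (0 , λ G G∈ → let c , proper = colour G∈ in c , proper⇒defect G proper)
  , λ { j (d , colourings) → defect-lower d colourings } ) ,
  ( (1 , λ G G∈ → let c , proper = colour G∈ in c , proper⇒clustering G proper)
  , λ { j (s , colourings) → defect-lower s λ G G∈ →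
        let c , clustered = colourings G G∈ in c , clustering⇒defect G clustered } ) ,
  -- The maximum is attained by the hard graph for defect `0`, because a proper colouring has defect
  -- `0`.
  ( (G₀ , G₀∈ , colour G₀∈ , λ { j (c , proper) → ℕ.≰⇒> λ j≤ → G₀-hard c j≤ (proper⇒defect G₀ proper) })
  , λ { j (G , G∈ , _ , minimal) → minimal _ (colour G∈) } )
  where
  q = ⌊ k /2⌋
  q<k : suc q ≤ k
  q<k = ℕ.⌊n/2⌋<n k′

  colour : ∀ {G} → TriangleFreeTreewidthAtMost k G → ∃[ c ] Proper G {suc (suc q)} c
  -- The number of slots `⌈ suc k /2⌉` computes to `suc q`, and after the rewriting `⌈ k + 3 /2⌉`
  -- computes to `suc (suc q)`.
  colour = colourable (suc q) (k<2⌈k+1/2⌉ k) (s≤s z≤n)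

  defect-lower : ∀ {j} d →
    (∀ G → TriangleFreeTreewidthAtMost k G → ∃ λ (c : Colouring G j) → HasDefect G c d) → suc (suc q) ≤ j
  defect-lower d colourings = ℕ.≰⇒> λ j≤ →
    let G , G∈ , hard = hard-graph q d (⌊k/2⌋+⌊k/2⌋≤k k) q<k
        c , defect = colourings G G∈
    in hard c j≤ defect

  hard₀ = hard-graph q 0 (⌊k/2⌋+⌊k/2⌋≤k k) q<k
  G₀ = proj₁ hard₀
  G₀∈ = proj₁ (proj₂ hard₀)
  G₀-hard = proj₂ (proj₂ hard₀)
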